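{- Let $\mathcal T=(S,2^S,\kappa,\mathrm{AP},\mathcal L)$ be a labelled denumerable Markov chain with a finite attractor, and let $\mathcal M=(Q,q_0,E,\mathcal F)$ be a deterministic Muller automaton over $\mathrm{AP}$. Let $B$ be a finite attractor for $\mathcal T\ltimes\mathcal M$. For every initial distribution $\mu\in\mathrm{Dist}(S)$ for $\mathcal T$: $\mathrm{Prob}^{\mathcal T\ltimes\mathcal M}_{\mu\times\delta_{q_0}}(\mathrm{Inf}\in\mathcal F)=1$ if and only if every BSCC $C$ of $\mathrm{Graph}_{\mathcal T\ltimes\mathcal M}(B)$ such that $\mathrm{Prob}^{\mathcal T\ltimes\mathcal M}_{\mu\times\delta_{q_0}}(\mathbf F C)>0$ is good for $\mathcal F$.
   Context: A labelled denumerable Markov chain is $\mathcal T=(S,2^S,\kappa,\mathrm{AP},\mathcal L)$ with $S$ at most countable, $\kappa$ a Markov kernel on $S$, $\mathrm{AP}$ a finite set of atomic propositions and $\mathcal L:S\to2^{\mathrm{AP}}$. $\mathrm{Dist}(S)$ is the set of probability measures on $S$; $\mathrm{Prob}^{\mathcal T}_\mu$ is the law on $S^\omega$ of the Markov chain with initial distribution $\mu$ and kernel $\kappa$. $\mathbf F B$ is the event that $B$ is visited at some time $i\ge0$. A set $B$ is an attractor for $\mathcal T$ if $\mathrm{Prob}^{\mathcal T}_\mu(\mathbf F B)=1$ for every initial distribution $\mu$. A deterministic Muller automaton over $\mathrm{AP}$ is $\mathcal M=(Q,q_0,E,\mathcal F)$ with $Q$ finite, $q_0\in Q$, $E\subseteq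 Q\times2^{\mathrm{AP}}\times Q$ such that for every $(q,u)$ there is exactly one $q'$ with $(q,u,q')\in E$, and $\mathcal F\subseteq2^Q$. The product $\mathcal T\ltimes\mathcal M$ is the labelled Markov chain with state space $S\times Q$, kernel $\kappa'((s,q),\{(s',q')\})=\kappa(s,\{s'\})$ if $(q,\mathcal L(s),q')\in E$ and $0$ otherwise, and labelling $(s,q)\mapsto q$. $\mathrm{Inf}\in\mathcal F$ is the event that the set of $q\in Q$ occurring infinitely often as second component along the path belongs to $\mathcal F$. $\mathrm{Graph}_{\mathcal T\ltimes\mathcal M}(B)$ is the finite directed graph with vertex set $B$ and an edge from $x$ to $y$ iff there is a path (finite sequence of positive-probability transitions) from $x$ to $y$ in $\mathcal T\ltimes\mathcal M$. A BSCC is a bottom strongly connected component of this graph. A BSCC $C$ is good for $\mathcal F$ if there is $F\in\mathcal F$ such that (a) for every $(s,q)\in S\times Q$ reachable by a path of $\mathcal T\ltimes\mathcal M$ from some element of $C$, $q\in F$; and (b) for every $q\in F$ there is $s\in S$ such that $(s,q)$ is reachable by a path from some element of $C$. -}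

module Defs where

open import Level using (0ℓ)
open import Algebra.Bundles using (CommutativeRing)
open import Data.Bool.Base using (if_then_else_)
open import Data.Fin.Base using (Fin; toℕ)
open import Data.Fin.Properties using (toℕ<n; toℕ-injective) renaming (_≟_ to _≟ᶠ_)
open import Data.Fin.Subset using (Subset; ⁅_⁆) renaming (_∈_ to _∈ˢ_)
open import Data.List.Base using (List; []; _∷_; foldr; map)
open import Data.List.Membership.Propositional using () renaming (_∈_ to _∈ˡ_)
open import Data.List.Relation.Unary.All as All using (All)
open import Data.List.Relation.Unary.AllPairs as AllPairs using (AllPairs)
open import Data.List.Relation.Unary.Unique.Propositional using (Unique)
import Data.List.Relation.Unary.Unique.Propositional.Properties as Unique
open import Data.Nat.Base as ℕ using (ℕ)
open import Data.Nat.DivMod using (_%_; [m+kn]%n≡m%n; m<n⇒m%n≡m)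
import Data.Nat.Properties as ℕ
open import Data.Product using (∃; ∃!; ∃-syntax; _×_; _,_; proj₁; proj₂)
open import Data.Unit.Base using (⊤)
open import Function.Base using (_∘_)
open import Function.Bundles using (_⇔_; _↣_; Injection; mk↣)
open import Relation.Binary.Core using (Rel)
open import Relation.Binary.Structures using (IsTotalOrder)
open import Relation.Binary.Construct.Closure.ReflexiveTransitive using (Star)
open import Relation.Binary.PropositionalEquality
  using (_≡_; _≢_; refl; sym; trans; cong; subst)
open import Relation.Nullary using (¬_; yes; no; does)
open import Relation.Nullary.Decidable using (map′; dec-true)
open import Relation.Unary using (Pred; _∈_; _≐_; _⊥_; ∁; U; ⋃)

-- The real numbers, through their usual axioms.  These determine ℝ up to
-- isomorphism only in classical logic.
record CompleteOrderedField : Set₁ where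
  field
    commutativeRing : CommutativeRing 0ℓ 0ℓ
  open CommutativeRing commutativeRing public
    renaming (refl to ≈-refl; sym to ≈-sym; trans to ≈-trans)
  infix 4 _≤_ _<_
  field
    _≤_          : Rel Carrier 0ℓ
    isTotalOrder : IsTotalOrder _≈_ _≤_
    0≉1          : ¬ (0# ≈ 1#)
    inverse      : ∀ x → ¬ (x ≈ 0#) → ∃[ y ] x * y ≈ 1#
    +-monoʳ-≤    : ∀ x {y z} → y ≤ z → x + y ≤ x + z
    *-nonneg     : ∀ {x y} → 0# ≤ x → 0# ≤ y → 0# ≤ x * y

  UpperBound : Pred Carrier 0ℓ → Pred Carrier 0ℓ
  UpperBound A u = ∀ x → x ∈ A → x ≤ u

  IsLub : Pred Carrier 0ℓ → Pred Carrier 0ℓ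
  IsLub A c = UpperBound A c × (∀ u → UpperBound A u → c ≤ u)

  field
    complete : ∀ A → ∃ A → ∃ (UpperBound A) → ∃ (IsLub A)

  open IsTotalOrder isTotalOrder public
    using () renaming (refl to ≤-refl; trans to ≤-trans; reflexive to ≤-reflexive)

  _<_ : Rel Carrier 0ℓ
  x < y = x ≤ y × ¬ (x ≈ y)

module _ {V : Set} where

  -- A finite directed graph with vertex set the members of the list B.
  record FiniteGraph : Set₁ where
    field
      vertices : List V
      Edge     : Rel V 0ℓ
      source   : ∀ {x y} → Edge x y → x ∈ˡ vertices
      target   : ∀ {x y} → Edge x y → y ∈ˡ vertices

  module _ (G : FiniteGraph) where
    open FiniteGraph G

    record IsSCC (C : Pred V 0ℓ) : Set where
      field
        nonempty  : ∃ C
        within    : ∀ {x} → x ∈ C → x ∈ˡ vertices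
        connected : ∀ {x y} → x ∈ C → y ∈ C → Star Edge x y
        maximal   : ∀ {x y} → x ∈ C → Star Edge x y → Star Edge y x → y ∈ C

    record IsBSCC (C : Pred V 0ℓ) : Set where
      field
        isSCC  : IsSCC C
        bottom : ∀ {x y} → x ∈ C → Edge x y → y ∈ C

-- k atomic propositions, n states.
record MullerAutomaton (k n : ℕ) : Set₁ where
  field
    q₀            : Fin n
    E             : Fin n → Subset k → Fin n → Set
    deterministic : ∀ q u → ∃! _≡_ (E q u)
    𝓕             : Pred (Subset n) 0ℓ

  E? : ∀ q u → Relation.Unary.Decidable (E q u)
  E? q u q′ with deterministic q u
  ... | q″ , e , unique = map′ (λ eq → subst (E q u) eq e) unique (q″ ≟ᶠ q′)

×-countable : ∀ {S : Set} {n} → S ↣ ℕ → (S × Fin n) ↣ ℕ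
×-countable {S} {n} i = mk↣ {to = code} λ { {_ , q} → code-injective {{nonZero q}} }
  where
  open Injection i using (to; injective)

  code : S × Fin n → ℕ
  code (s , q) = toℕ q ℕ.+ to s ℕ.* n

  nonZero : Fin n → ℕ.NonZero n
  nonZero q = ℕ.>-nonZero (ℕ.≤-<-trans ℕ.z≤n (toℕ<n q))

  residue : ∀ {{_ : ℕ.NonZero n}} s (q : Fin n) → code (s , q) % n ≡ toℕ q
  residue s q = trans ([m+kn]%n≡m%n (toℕ q) (to s) n) (m<n⇒m%n≡m (toℕ<n q))

  code-injective : ∀ {{_ : ℕ.NonZero n}} {x y} → code x ≡ code y → x ≡ y
  code-injective {s , q} {s′ , q′} eq
    with refl ← toℕ-injective {i = q} {q′}
           (trans (sym (residue s q)) (trans (cong (_% n) eq) (residue s′ q′)))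
    with refl ← injective (ℕ.*-cancelʳ-≡ (to s) (to s′) n
           (ℕ.+-cancelˡ-≡ (toℕ q) _ _ eq))
    = refl

-- Paths of a process, and the product σ-algebra of 2^S on S^ω.
module _ {S : Set} where

  Event : Set₁
  Event = Pred (ℕ → S) 0ℓ

  data Measurable : Pred Event (Level.suc 0ℓ) where
    coordinate : ∀ i (A : Pred S 0ℓ) → Measurable (λ ω → ω i ∈ A)
    complement : ∀ {A} → Measurable A → Measurable (∁ A)
    union      : ∀ {A : ℕ → Event} → (∀ i → Measurable (A i)) → Measurable (⋃ ℕ A)
    respects   : ∀ {A B} → A ≐ B → Measurable A → Measurable B

  -- The paths which start with the given word.
  Cylinder : List S → Event
  Cylinder []      ω = ⊤
  Cylinder (x ∷ w) ω = ω 0 ≡ x × Cylinder w (ω ∘ ℕ.suc)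

  𝐅 : Pred S 0ℓ → Event
  𝐅 B ω = ∃[ i ] ω i ∈ B

-- The states q which occur infinitely often form a member of 𝓕.
Inf∈ : ∀ {S n} → Pred (Subset n) 0ℓ → Event {S × Fin n}
Inf∈ {n = n} 𝓕 ω = ∃[ F ] F ∈ 𝓕 × (∀ q → q ∈ˢ F ⇔ InfinitelyOften q)
  where
  InfinitelyOften : Fin n → Set
  InfinitelyOften q = ∀ N → ∃[ i ] N ℕ.≤ i × proj₂ (ω i) ≡ q

module Probability (ℝ : CompleteOrderedField) where
  open CompleteOrderedField ℝ

  ∑ : ∀ {I : Set} → (I → Carrier) → List I → Carrier
  ∑ f = foldr (λ i a → f i + a) 0#

  -- For families of nonnegative terms only: the supremum of the finite sums.
  HasSum : ∀ {I : Set} → (I → Carrier) → Carrier → Set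
  HasSum f = IsLub (λ x → ∃[ l ] Unique l × x ≈ ∑ f l)

  -- Probability measures on a countable S with σ-algebra 2^S, given by
  -- the masses of the points.
  record Dist (S : Set) : Set where
    field
      mass   : S → Carrier
      nonneg : ∀ s → 0# ≤ mass s
      total  : HasSum mass 1#
  open Dist public using (mass)

  -- P is a total function on events, but only its values on measurable
  -- events are constrained and meaningful.
  record IsProbabilityMeasure {S : Set} (P : Event {S} → Carrier) : Set₁ where
    field
      nonneg     : ∀ {A} → Measurable A → 0# ≤ P A
      P-cong     : ∀ {A B} → Measurable A → A ≐ B → P A ≈ P B
      total      : P U ≈ 1#
      σ-additive : ∀ (A : ℕ → Event) → (∀ i → Measurable (A i)) →
                   (∀ i j → i ≢ j → A i ⊥ A j) →
                   HasSum (λ i → P (A i)) (P (⋃ ℕ A))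

  -- The atomic propositions are Fin k.
  record LabelledMarkovChain (S : Set) (k : ℕ) : Set where
    field
      countable : S ↣ ℕ
      κ         : S → Dist S
      𝓛         : S → Subset k

  module _ {S : Set} {k : ℕ} (𝓣 : LabelledMarkovChain S k) where
    open LabelledMarkovChain 𝓣

    transitions : S → List S → Carrier
    transitions x []      = 1#
    transitions x (y ∷ w) = mass (κ x) y * transitions y w

    -- P is the law of the chain with initial distribution μ.  It exists and
    -- is unique on measurable events (Ionescu-Tulcea).
    record IsLaw (μ : Dist S) (P : Event {S} → Carrier) : Set₁ where
      field
        isProbabilityMeasure : IsProbabilityMeasure P
        cylinder             : ∀ x w → P (Cylinder (x ∷ w)) ≈ mass μ x * transitions x w

    IsAttractor : Pred S 0ℓ → Set₁
    IsAttractor B = ∀ μ P → IsLaw μ P → P (𝐅 B) ≈ 1#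

    IsFiniteAttractor : List S → Set₁
    IsFiniteAttractor B = IsAttractor (_∈ˡ B)

    Path : Rel S 0ℓ
    Path = Star (λ x y → 0# < mass (κ x) y)

    Graph : List S → FiniteGraph
    Graph B = record
      { vertices = B
      ; Edge     = λ x y → x ∈ˡ B × y ∈ˡ B × Path x y
      ; source   = proj₁
      ; target   = proj₁ ∘ proj₂
      }

  -- Mass f s on each pair (s , q) with D s q, where D is functional.
  module _ {S : Set} {n : ℕ} {D : S → Fin n → Set}
           (D? : ∀ s → Relation.Unary.Decidable (D s))
           (functional : ∀ s → ∃! _≡_ (D s)) where

    spreadMass : (S → Carrier) → S × Fin n → Carrier
    spreadMass f (s , q) = if does (D? s q) then f s else 0#

    keep : List (S × Fin n) → List S
    keep []            = []
    keep ((s , q) ∷ l) with D? s q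
    ... | yes _ = s ∷ keep l
    ... | no  _ = keep l

    keep-fresh : ∀ {s q} → D s q → ∀ l → All ((s , q) ≢_) l → All (s ≢_) (keep l)
    keep-fresh d []              All.[]         = All.[]
    keep-fresh {s} {q} d ((s′ , q′) ∷ l) (x≢ All.∷ xs) with D? s′ q′
    ... | no  _  = keep-fresh d l xs
    ... | yes d′ = s≢s′ All.∷ keep-fresh d l xs
      where
      s≢s′ : s ≢ s′
      s≢s′ refl = x≢ (cong (s ,_) (trans (sym (unique d)) (unique d′)))
        where
        unique : ∀ {q} → D s q → proj₁ (functional s) ≡ q
        unique = proj₂ (proj₂ (functional s))

    keep-unique : ∀ l → Unique l → Unique (keep l)
    keep-unique []            _                    = AllPairs.[]
    keep-unique ((s , q) ∷ l) (x≢ AllPairs.∷ u) with D? s q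
    ... | yes d = keep-fresh d l x≢ AllPairs.∷ keep-unique l u
    ... | no  _ = keep-unique l u

    keep-∑ : ∀ f l → ∑ (spreadMass f) l ≈ ∑ f (keep l)
    keep-∑ f []            = ≈-refl
    keep-∑ f ((s , q) ∷ l) with D? s q
    ... | yes _ = +-congˡ (keep-∑ f l)
    ... | no  _ = ≈-trans (+-identityˡ _) (keep-∑ f l)

    pair : S → S × Fin n
    pair s = s , proj₁ (functional s)

    pair-∑ : ∀ f l → ∑ f l ≈ ∑ (spreadMass f) (map pair l)
    pair-∑ f []      = ≈-refl
    pair-∑ f (s ∷ l)
      rewrite dec-true (D? s (proj₁ (functional s))) (proj₁ (proj₂ (functional s)))
      = +-congˡ (pair-∑ f l)

    spread : Dist S → Dist (S × Fin n)
    spread μ = record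
      { mass   = spreadMass (mass μ)
      ; nonneg = nonneg′
      ; total  =
          (λ { x (l , u , eq) → proj₁ μ.total x
                 (keep l , keep-unique l u , ≈-trans eq (keep-∑ μ.mass l)) })
        , (λ b bound → proj₂ μ.total b
             (λ { x (l , u , eq) → bound x
                    ( map pair l , Unique.map⁺ (cong proj₁) u
                    , ≈-trans eq (pair-∑ μ.mass l)) }))
      }
      where
      module μ = Dist μ
      nonneg′ : ∀ x → 0# ≤ spreadMass μ.mass x
      nonneg′ (s , q) with D? s q
      ... | yes _ = μ.nonneg s
      ... | no  _ = ≤-refl

  infix 7 _×δ_
  _×δ_ : ∀ {S n} → Dist S → Fin n → Dist (S × Fin n)
  μ ×δ q₀ = spread (λ _ q → q₀ ≟ᶠ q) (λ _ → q₀ , refl , λ eq → eq) μ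

  infix 7 _⋉_
  _⋉_ : ∀ {S k n} → LabelledMarkovChain S k → MullerAutomaton k n →
        LabelledMarkovChain (S × Fin n) n
  𝓣 ⋉ 𝓜 = record
    { countable = ×-countable countable
    ; κ         = λ (s , q) →
        spread (λ _ → E? q (𝓛 s)) (λ _ → deterministic q (𝓛 s)) (κ s)
    ; 𝓛         = λ (s , q) → ⁅ q ⁆
    }
    where
    open LabelledMarkovChain 𝓣
    open MullerAutomaton 𝓜

  module _ {S : Set} {k n : ℕ} (𝓣 : LabelledMarkovChain S k) (𝓜 : MullerAutomaton k n) where
    open MullerAutomaton 𝓜

    ReachableFrom : Pred (S × Fin n) 0ℓ → Pred (S × Fin n) 0ℓ
    ReachableFrom C y = ∃[ x ] x ∈ C × Path (𝓣 ⋉ 𝓜) x y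

    IsGood : Pred (S × Fin n) 0ℓ → Set
    IsGood C = ∃[ F ] F ∈ 𝓕
      × (∀ s q → (s , q) ∈ ReachableFrom C → q ∈ˢ F)
      × (∀ q → q ∈ˢ F → ∃[ s ] (s , q) ∈ ReachableFrom C)

{-# OPTIONS --safe #-}

-- Let P be the law of a chain with a finite attractor B.  The shifted measures
-- P ∘ shift n are again laws of the chain, so B is almost surely visited
-- infinitely often, hence so is one of its points.  If κ x y > 0, then almost
-- surely x is visited finitely often or the transition from x to y is taken
-- infinitely often.  So almost surely the recurrent points of B include a
-- whole BSCC C, and from the first visit to C on, the path visits exactly the
-- states reachable from C, each infinitely often; the set Inf is then the set
-- of second components of these states.

module Submission where

open import Defs
open import Level using (0ℓ)
open import Axiom.ExcludedMiddle using (ExcludedMiddle)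
import Algebra.Properties.Ring
open import Data.Empty using (⊥-elim) renaming (⊥ to Empty)
open import Data.Fin.Base using (Fin)
open import Data.Fin.Properties using (toℕ-injective)
open import Data.Fin.Subset using (Subset; inside; outside)
open import Data.Fin.Subset.Properties using (∃-Subset-[]-⇔; ∃-Subset-∷-⇔)
open import Data.List.Base using (List; []; _∷_; map; length; _∷ʳ_; _++_)
open import Data.List.Membership.Propositional using () renaming (_∈_ to _∈ˡ_)
open import Data.List.Properties using (length-++)
open import Data.List.Relation.Unary.All as All using (All)
open import Data.List.Relation.Unary.AllPairs as AllPairs using (AllPairs)
open import Data.List.Relation.Unary.Any using (here; there)
open import Data.List.Relation.Unary.Unique.Propositional using (Unique)
import Data.List.Relation.Unary.Unique.Propositional.Properties as Unique
open import Data.Nat.Base as ℕ using (ℕ; zero; suc)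
open import Data.Nat.Induction using (<-rec)
import Data.Nat.Properties as ℕ
open import Data.Product using (∃; ∃-syntax; _×_; _,_; proj₁; proj₂)
open import Data.Sum.Base using (inj₁; inj₂)
open import Data.Unit.Base using (⊤; tt)
open import Data.Vec.Base using ([]; _∷_)
open import Function.Base using (_∘_; id)
open import Function.Bundles using (_⇔_; _↣_; Injection; Equivalence; mk↣; mk⇔)
open import Function.Construct.Identity using (↣-id)
open import Relation.Binary.Bundles using (Poset)
open import Relation.Binary.Construct.Closure.ReflexiveTransitive using (Star; ε; _◅_; _◅◅_)
open import Relation.Binary.Core using (Rel)
open import Relation.Binary.Definitions using (tri<; tri≈; tri>)
open import Relation.Binary.PropositionalEquality using (_≡_; _≢_; refl; sym; trans; cong; subst)
import Relation.Binary.Reasoning.PartialOrder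
open import Relation.Binary.Structures using (IsTotalOrder)
open import Relation.Nullary using (¬_; yes; no)
open import Relation.Nullary.Decidable using (decidable-stable)
open import Relation.Unary using (Pred; _∈_; _⊆_; _≐_; _⊥_; ∁; U; ∅; _∩_; _∪_; ⋃; ⋂)

-- All that is given of `P` is σ-additivity on measurable events and the formula for cylinders. The
-- Markov property is therefore derived for events of the past, those that depend on finitely many
-- coordinates: once these coordinates are fixed, it reduces to the cylinder formula. The recurrence
-- argument only ever conditions on such events, because whether a visit is the first of its kind is
-- decided by the past.
--
-- A second obstacle is that a BSCC is an arbitrary predicate on states, and predicates do not come
-- as a countable family, whereas almost sure conditions can only be intersected countably often. In
-- the direction from good components to `Inf∈`, components are therefore taken in the form
-- `Class B x`, indexed by the states `x`.
--
-- After the null sets are discarded, both directions are statements about a single path.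

module OrderedField (ℝ : CompleteOrderedField) where
  open CompleteOrderedField ℝ
  open Algebra.Properties.Ring ring using (-‿distribˡ-*; -‿distribʳ-*; -‿involutive)

  poset : Poset 0ℓ 0ℓ 0ℓ
  poset = record { isPartialOrder = IsTotalOrder.isPartialOrder isTotalOrder }

  module ≤-Reasoning = Relation.Binary.Reasoning.PartialOrder poset
  open ≤-Reasoning

  ≤-antisym : ∀ {x y} → x ≤ y → y ≤ x → x ≈ y
  ≤-antisym = IsTotalOrder.antisym isTotalOrder

  +-monoˡ-≤ : ∀ x {y z} → y ≤ z → y + x ≤ z + x
  +-monoˡ-≤ x {y} {z} y≤z = begin
    y + x ≈⟨ +-comm y x ⟩
    x + y ≤⟨ +-monoʳ-≤ x y≤z ⟩
    x + z ≈⟨ +-comm x z ⟩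
    z + x ∎

  -x+[x+y]≈y : ∀ x y → - x + (x + y) ≈ y
  -x+[x+y]≈y x y = begin-equality
    - x + (x + y) ≈⟨ +-assoc (- x) x y ⟨
    (- x + x) + y ≈⟨ +-congʳ (-‿inverseˡ x) ⟩
    0# + y        ≈⟨ +-identityˡ y ⟩
    y             ∎

  x+[-x+y]≈y : ∀ x y → x + (- x + y) ≈ y
  x+[-x+y]≈y x y = begin-equality
    x + (- x + y) ≈⟨ +-assoc x (- x) y ⟨
    (x + - x) + y ≈⟨ +-congʳ (-‿inverseʳ x) ⟩
    0# + y        ≈⟨ +-identityˡ y ⟩
    y             ∎

  -- Leastness of a supremum bounds `s` alone. This lemma and its converse below move a summand
  -- across, so that leastness also bounds `x + s`.
  x+y≤z⇒y≤-x+z : ∀ {x y z} → x + y ≤ z → y ≤ - x + z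
  x+y≤z⇒y≤-x+z {x} {y} {z} x+y≤z = begin
    y             ≈⟨ -x+[x+y]≈y x y ⟨
    - x + (x + y) ≤⟨ +-monoʳ-≤ (- x) x+y≤z ⟩
    - x + z       ∎

  y≤-x+z⇒x+y≤z : ∀ {x y z} → y ≤ - x + z → x + y ≤ z
  y≤-x+z⇒x+y≤z {x} {y} {z} y≤-x+z = begin
    x + y         ≤⟨ +-monoʳ-≤ x y≤-x+z ⟩
    x + (- x + z) ≈⟨ x+[-x+y]≈y x z ⟩
    z             ∎

  +-cancelˡ-≤ : ∀ x {y z} → x + y ≤ x + z → y ≤ z
  +-cancelˡ-≤ x {y} {z} le = ≤-trans (x+y≤z⇒y≤-x+z le) (≤-reflexive (-x+[x+y]≈y x z))

  +-cancelˡ : ∀ x {y z} → x + y ≈ x + z → y ≈ z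
  +-cancelˡ x eq = ≤-antisym (+-cancelˡ-≤ x (≤-reflexive eq))
                             (+-cancelˡ-≤ x (≤-reflexive (≈-sym eq)))

  x≤y+x : ∀ {x y} → 0# ≤ y → x ≤ y + x
  x≤y+x {x} {y} 0≤y = begin
    x      ≈⟨ +-identityˡ x ⟨
    0# + x ≤⟨ +-monoˡ-≤ x 0≤y ⟩
    y + x  ∎

  x≤x+y : ∀ {x y} → 0# ≤ y → x ≤ x + y
  x≤x+y {x} {y} 0≤y = ≤-trans (x≤y+x 0≤y) (≤-reflexive (+-comm y x))

  *-monoʳ-≤ : ∀ {x y z} → 0# ≤ z → x ≤ y → x * z ≤ y * z
  *-monoʳ-≤ {x} {y} {z} 0≤z x≤y = begin
    x * z                     ≤⟨ x≤x+y (*-nonneg 0≤-x+y 0≤z) ⟩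
    x * z + (- x + y) * z     ≈⟨ distribʳ z x (- x + y) ⟨
    (x + (- x + y)) * z       ≈⟨ *-congʳ (x+[-x+y]≈y x y) ⟩
    y * z                     ∎
    where
    0≤-x+y : 0# ≤ - x + y
    0≤-x+y = x+y≤z⇒y≤-x+z (≤-trans (≤-reflexive (+-identityʳ x)) x≤y)

  x≤0⇒0≤-x : ∀ {x} → x ≤ 0# → 0# ≤ - x
  x≤0⇒0≤-x {x} x≤0 = begin
    0#       ≤⟨ x+y≤z⇒y≤-x+z (≤-trans (≤-reflexive (+-identityʳ x)) x≤0) ⟩
    - x + 0# ≈⟨ +-identityʳ (- x) ⟩
    - x      ∎

  0≤x*x : ∀ x → 0# ≤ x * x
  0≤x*x x with IsTotalOrder.total isTotalOrder 0# x
  ... | inj₁ 0≤x = *-nonneg 0≤x 0≤x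
  ... | inj₂ x≤0 = begin
    0#          ≤⟨ *-nonneg (x≤0⇒0≤-x x≤0) (x≤0⇒0≤-x x≤0) ⟩
    - x * - x   ≈⟨ -‿distribˡ-* x (- x) ⟨
    - (x * - x) ≈⟨ -‿cong (-‿distribʳ-* x x) ⟨
    - - (x * x) ≈⟨ -‿involutive (x * x) ⟩
    x * x       ∎

  -- y = x y² ≥ 0.
  inverse-nonneg : ∀ {x y} → 0# ≤ x → x * y ≈ 1# → 0# ≤ y
  inverse-nonneg {x} {y} 0≤x xy≈1 = begin
    0#          ≤⟨ *-nonneg 0≤x (0≤x*x y) ⟩
    x * (y * y) ≈⟨ *-assoc x y y ⟨
    x * y * y   ≈⟨ *-congʳ xy≈1 ⟩
    1# * y      ≈⟨ *-identityˡ y ⟩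
    y           ∎

  x*y≈0⇒x≈0 : ∀ {x y} → x * y ≈ 0# → ¬ (y ≈ 0#) → x ≈ 0#
  x*y≈0⇒x≈0 {x} {y} xy≈0 y≉0 with inverse y y≉0
  ... | z , yz≈1 = begin-equality
    x           ≈⟨ *-identityʳ x ⟨
    x * 1#      ≈⟨ *-congˡ yz≈1 ⟨
    x * (y * z) ≈⟨ *-assoc x y z ⟨
    x * y * z   ≈⟨ *-congʳ xy≈0 ⟩
    0# * z      ≈⟨ zeroˡ z ⟩
    0#          ∎

-- Suprema of finite sums.

module Sum (em : ExcludedMiddle 0ℓ) (ℝ : CompleteOrderedField) where
  open CompleteOrderedField ℝ
  open Probability ℝ
  open OrderedField ℝ
  open ≤-Reasoning

  module _ {I : Set} where

    ∑-cong : ∀ {f g : I → Carrier} → (∀ i → f i ≈ g i) → ∀ l → ∑ f l ≈ ∑ g l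
    ∑-cong f≈g []      = ≈-refl
    ∑-cong f≈g (i ∷ l) = +-cong (f≈g i) (∑-cong f≈g l)

    ∑-zero : ∀ {f : I → Carrier} → (∀ i → f i ≈ 0#) → ∀ l → ∑ f l ≈ 0#
    ∑-zero f≈0 []      = ≈-refl
    ∑-zero f≈0 (i ∷ l) = ≈-trans (+-cong (f≈0 i) (∑-zero f≈0 l)) (+-identityˡ 0#)

    ∑-*ʳ : ∀ (f : I → Carrier) c l → ∑ (λ i → f i * c) l ≈ ∑ f l * c
    ∑-*ʳ f c []      = ≈-sym (zeroˡ c)
    ∑-*ʳ f c (i ∷ l) = ≈-trans (+-congˡ (∑-*ʳ f c l)) (≈-sym (distribʳ c (f i) (∑ f l)))

    HasSum-unique : ∀ {f : I → Carrier} {s t} → HasSum f s → HasSum f t → s ≈ t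
    HasSum-unique (s-ub , s-least) (t-ub , t-least) =
      ≤-antisym (s-least _ t-ub) (t-least _ s-ub)

    hasSum : ∀ {f : I → Carrier} {s} → (∀ l → Unique l → ∑ f l ≤ s) →
             (∀ b → (∀ l → Unique l → ∑ f l ≤ b) → s ≤ b) → HasSum f s
    hasSum ub least =
      (λ { x (l , u , x≈) → ≤-trans (≤-reflexive x≈) (ub l u) }) ,
      (λ b bound → least b λ l u → bound _ (l , u , ≈-refl))

    ∑≤ : ∀ {f : I → Carrier} {s} → HasSum f s → ∀ l → Unique l → ∑ f l ≤ s
    ∑≤ (ub , _) l u = ub _ (l , u , ≈-refl)

    sum-least : ∀ {f : I → Carrier} {s} → HasSum f s →
                ∀ b → (∀ l → Unique l → ∑ f l ≤ b) → s ≤ b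
    sum-least (_ , least) b bound =
      least b λ { x (l , u , x≈) → ≤-trans (≤-reflexive x≈) (bound l u) }

    HasSum-cong : ∀ {f g : I → Carrier} {s} → (∀ i → f i ≈ g i) → HasSum f s → HasSum g s
    HasSum-cong f≈g h = hasSum
      (λ l u → ≤-trans (≤-reflexive (≈-sym (∑-cong f≈g l))) (∑≤ h l u))
      (λ b bound → sum-least h b λ l u → ≤-trans (≤-reflexive (∑-cong f≈g l)) (bound l u))

    HasSum-resp : ∀ {f : I → Carrier} {s t} → s ≈ t → HasSum f s → HasSum f t
    HasSum-resp s≈t h = hasSum
      (λ l u → ≤-trans (∑≤ h l u) (≤-reflexive s≈t))
      (λ b bound → ≤-trans (≤-reflexive (≈-sym s≈t)) (sum-least h b bound))

    HasSum-zero : ∀ {f : I → Carrier} → (∀ i → f i ≈ 0#) → HasSum f 0#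
    HasSum-zero f≈0 = hasSum
      (λ l _ → ≤-reflexive (∑-zero f≈0 l))
      (λ b bound → bound [] AllPairs.[])

    HasSum-*ʳ : ∀ {f : I → Carrier} {s c} → 0# ≤ c → HasSum f s →
                HasSum (λ i → f i * c) (s * c)
    HasSum-*ʳ {f} {s} {c} 0≤c h = hasSum
      (λ l u → ≤-trans (≤-reflexive (∑-*ʳ f c l)) (*-monoʳ-≤ 0≤c (∑≤ h l u)))
      least
      where
      least : ∀ b → (∀ l → Unique l → ∑ (λ i → f i * c) l ≤ b) → s * c ≤ b
      least b bound with em {c ≈ 0#}
      -- Leastness is proved by dividing by `c`; at `c ≈ 0#` the empty list supplies `0# ≤ b`
      -- instead.
      ... | yes c≈0 = begin
        s * c  ≈⟨ *-congˡ c≈0 ⟩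
        s * 0# ≈⟨ zeroʳ s ⟩
        0#     ≤⟨ bound [] AllPairs.[] ⟩
        b      ∎
      ... | no c≉0 with inverse c c≉0
      ... | d , cd≈1 = begin
        s * c       ≤⟨ *-monoʳ-≤ 0≤c (sum-least h (b * d) scaled) ⟩
        b * d * c   ≈⟨ *-assoc b d c ⟩
        b * (d * c) ≈⟨ *-congˡ (≈-trans (*-comm d c) cd≈1) ⟩
        b * 1#      ≈⟨ *-identityʳ b ⟩
        b           ∎
        where
        scaled : ∀ l → Unique l → ∑ f l ≤ b * d
        scaled l u = begin
          ∑ f l                   ≈⟨ *-identityʳ _ ⟨
          ∑ f l * 1#              ≈⟨ *-congˡ cd≈1 ⟨
          ∑ f l * (c * d)         ≈⟨ *-assoc _ c d ⟨
          ∑ f l * c * d           ≈⟨ *-congʳ (∑-*ʳ f c l) ⟨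
          ∑ (λ i → f i * c) l * d ≤⟨ *-monoʳ-≤ (inverse-nonneg 0≤c cd≈1) (bound l u) ⟩
          b * d                   ∎

  preds : List ℕ → List ℕ
  preds []          = []
  preds (zero ∷ l)  = preds l
  preds (suc i ∷ l) = i ∷ preds l

  preds-fresh : ∀ {i} l → All (suc i ≢_) l → All (i ≢_) (preds l)
  preds-fresh []          All.[]         = All.[]
  preds-fresh (zero ∷ l)  (_ All.∷ i≢)   = preds-fresh l i≢
  preds-fresh (suc j ∷ l) (i≢j All.∷ i≢) = (i≢j ∘ cong suc) All.∷ preds-fresh l i≢

  preds-unique : ∀ l → Unique l → Unique (preds l)
  preds-unique []          _                    = AllPairs.[]
  preds-unique (zero ∷ l)  (_ AllPairs.∷ u)     = preds-unique l u
  preds-unique (suc i ∷ l) (fresh AllPairs.∷ u) = preds-fresh l fresh AllPairs.∷ preds-unique l u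

  ∑-preds : ∀ f l → All (0 ≢_) l → ∑ f l ≈ ∑ (f ∘ suc) (preds l)
  ∑-preds f []          _            = ≈-refl
  ∑-preds f (zero ∷ l)  (0≢ All.∷ _) = ⊥-elim (0≢ refl)
  ∑-preds f (suc i ∷ l) (_ All.∷ 0∉) = +-congˡ (∑-preds f l 0∉)

  -- Only an inequality, since `0` may be missing from `l`; `f 0` is then added for free because it
  -- is nonnegative. Uniqueness of `l` keeps `0` from being dropped twice by `preds`.
  ∑≤head+∑-preds : ∀ f → 0# ≤ f 0 → ∀ l → Unique l → ∑ f l ≤ f 0 + ∑ (f ∘ suc) (preds l)
  ∑≤head+∑-preds f 0≤f0 []          _                  = x≤y+x 0≤f0
  ∑≤head+∑-preds f 0≤f0 (zero ∷ l)  (0∉ AllPairs.∷ _)  = +-monoʳ-≤ (f 0) (≤-reflexive (∑-preds f l 0∉))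
  ∑≤head+∑-preds f 0≤f0 (suc i ∷ l) (_ AllPairs.∷ u)   = begin
    f (suc i) + ∑ f l              ≤⟨ +-monoʳ-≤ _ (∑≤head+∑-preds f 0≤f0 l u) ⟩
    f (suc i) + (f 0 + rest)       ≈⟨ +-assoc _ _ _ ⟨
    (f (suc i) + f 0) + rest       ≈⟨ +-congʳ (+-comm _ _) ⟩
    (f 0 + f (suc i)) + rest       ≈⟨ +-assoc _ _ _ ⟩
    f 0 + (f (suc i) + rest)       ∎
    where rest = ∑ (f ∘ suc) (preds l)

  HasSum-∷ : ∀ {f : ℕ → Carrier} {s} → 0# ≤ f 0 → HasSum (f ∘ suc) s → HasSum f (f 0 + s)
  HasSum-∷ {f} {s} 0≤f0 h = hasSum
    (λ l u → ≤-trans (∑≤head+∑-preds f 0≤f0 l u) (+-monoʳ-≤ (f 0) (∑≤ h (preds l) (preds-unique l u))))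
    (λ b bound → y≤-x+z⇒x+y≤z (sum-least h _ λ l u → x+y≤z⇒y≤-x+z
      (≤-trans (≤-reflexive (+-congˡ (∑-suc l)))
        (bound (0 ∷ map suc l) (fresh l AllPairs.∷ Unique.map⁺ ℕ.suc-injective u)))))
    where
    ∑-suc : ∀ l → ∑ (f ∘ suc) l ≈ ∑ f (map suc l)
    ∑-suc []      = ≈-refl
    ∑-suc (i ∷ l) = +-congˡ (∑-suc l)

    fresh : ∀ l → All (0 ≢_) (map suc l)
    fresh []      = All.[]
    fresh (i ∷ l) = (λ ()) All.∷ fresh l

  module _ {I : Set} (I↣ℕ : I ↣ ℕ) where
    open Injection I↣ℕ using (to; injective)

    preimages : List ℕ → List I
    preimages []      = []
    preimages (n ∷ l) with em {∃ λ i → to i ≡ n}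
    ... | yes (i , _) = i ∷ preimages l
    ... | no  _       = preimages l

    preimages-fresh : ∀ i l → All (to i ≢_) l → All (i ≢_) (preimages l)
    preimages-fresh i []      All.[]         = All.[]
    preimages-fresh i (n ∷ l) (i≢n All.∷ i∉) with em {∃ λ i → to i ≡ n}
    ... | yes (j , refl) = (i≢n ∘ cong to) All.∷ preimages-fresh i l i∉
    ... | no  _          = preimages-fresh i l i∉

    preimages-unique : ∀ l → Unique l → Unique (preimages l)
    preimages-unique []      _                    = AllPairs.[]
    preimages-unique (n ∷ l) (fresh AllPairs.∷ u) with em {∃ λ i → to i ≡ n}
    ... | yes (i , refl) = preimages-fresh i l fresh AllPairs.∷ preimages-unique l u
    ... | no  _          = preimages-unique l u

    ∑-preimages : ∀ {f : ℕ → Carrier} → (∀ n → ¬ (∃ λ i → to i ≡ n) → f n ≈ 0#) →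
                  ∀ l → ∑ f l ≈ ∑ (f ∘ to) (preimages l)
    ∑-preimages f≈0 []      = ≈-refl
    ∑-preimages f≈0 (n ∷ l) with em {∃ λ i → to i ≡ n}
    ... | yes (i , refl) = +-congˡ (∑-preimages f≈0 l)
    ... | no  n∉         = ≈-trans (+-cong (f≈0 n n∉) (∑-preimages f≈0 l)) (+-identityˡ _)

    -- Passes from sums over `ℕ`, the form in which σ-additivity is stated, to sums over a countable
    -- set such as the state space. Numbers that code nothing contribute zero.
    HasSum-↣ : ∀ {f : ℕ → Carrier} {s} → (∀ n → ¬ (∃ λ i → to i ≡ n) → f n ≈ 0#) →
               HasSum f s → HasSum (f ∘ to) s
    HasSum-↣ {f} f≈0 h = hasSum
      (λ l u → ≤-trans (≤-reflexive (∑-to l)) (∑≤ h (map to l) (Unique.map⁺ injective u)))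
      (λ b bound → sum-least h b λ l u →
        ≤-trans (≤-reflexive (∑-preimages f≈0 l)) (bound (preimages l) (preimages-unique l u)))
      where
      ∑-to : ∀ l → ∑ (f ∘ to) l ≈ ∑ f (map to l)
      ∑-to []      = ≈-refl
      ∑-to (i ∷ l) = +-congˡ (∑-to l)

-- Measurability of events.

module _ (em : ExcludedMiddle 0ℓ) where

  ¬∀⇒∃¬ : ∀ {I : Set} {Q : I → Set} → ¬ (∀ i → Q i) → ∃ λ i → ¬ Q i
  ¬∀⇒∃¬ ¬∀ = decidable-stable em λ ¬∃ → ¬∀ λ i → decidable-stable em λ ¬q → ¬∃ (i , ¬q)

  least : ∀ {Q : ℕ → Set} → ∃ Q → ∃ λ n → Q n × (∀ m → m ℕ.< n → ¬ Q m)
  least {Q} (n , q) = <-rec (λ n → Q n → ∃ λ n → Q n × (∀ m → m ℕ.< n → ¬ Q m)) step n q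
    where
    step : ∀ n → (∀ {m} → m ℕ.< n → Q m → ∃ λ n → Q n × (∀ m → m ℕ.< n → ¬ Q m)) →
           Q n → ∃ λ n → Q n × (∀ m → m ℕ.< n → ¬ Q m)
    step n rec q with em {∃ λ m → m ℕ.< n × Q m}
    ... | yes (m , m<n , qm) = rec m<n qm
    ... | no  none           = n , q , λ m m<n qm → none (m , m<n , qm)

  -- The usual disjointification of a sequence: the union stays the same, and σ-additivity becomes
  -- applicable.
  first : ∀ {S : Set} → (ℕ → Event {S}) → ℕ → Event {S}
  first A n ω = ω ∈ A n × (∀ m → m ℕ.< n → ¬ ω ∈ A m)

  first-disjoint : ∀ {S : Set} (A : ℕ → Event {S}) m n → m ≢ n → first A m ⊥ first A n
  first-disjoint A m n m≢n ((am , m-first) , (an , n-first)) with ℕ.<-cmp m n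
  ... | tri< m<n _ _ = n-first m m<n am
  ... | tri≈ _ m≡n _ = m≢n m≡n
  ... | tri> _ _ n<m = m-first n n<m an

  ⋃-first : ∀ {S : Set} (A : ℕ → Event {S}) → ⋃ ℕ (first A) ≐ ⋃ ℕ A
  ⋃-first A = (λ (n , a , _) → n , a) , least

  module _ {S : Set} where

    -- A condition that does not mention the path is a coordinate condition whose set of states
    -- ignores its argument. This lets side conditions such as `K ≤ m` stand inside events.
    const-measurable : ∀ (X : Set) → Measurable {S} (λ _ → X)
    const-measurable X = coordinate 0 (λ _ → X)

    U-measurable : Measurable {S} U
    U-measurable = const-measurable ⊤

    ∪-measurable : ∀ {A B : Event {S}} → Measurable A → Measurable B → Measurable (A ∪ B)
    ∪-measurable {A} {B} mA mB = respects (to , from) (union {A = family} measurable)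
      where
      family : ℕ → Event {S}
      family zero    = A
      family (suc _) = B

      measurable : ∀ i → Measurable (family i)
      measurable zero    = mA
      measurable (suc _) = mB

      to : ⋃ ℕ family ⊆ A ∪ B
      to (zero  , a) = inj₁ a
      to (suc _ , b) = inj₂ b

      from : A ∪ B ⊆ ⋃ ℕ family
      from (inj₁ a) = 0 , a
      from (inj₂ b) = 1 , b

    ∩-measurable : ∀ {A B : Event {S}} → Measurable A → Measurable B → Measurable (A ∩ B)
    ∩-measurable mA mB = respects
      ( (λ n → decidable-stable em (n ∘ inj₁) , decidable-stable em (n ∘ inj₂))
      , (λ { (a , b) (inj₁ ¬a) → ¬a a ; (a , b) (inj₂ ¬b) → ¬b b }))
      (complement (∪-measurable (complement mA) (complement mB)))

    →-measurable : ∀ {A B : Event {S}} → Measurable A → Measurable B →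
                   Measurable (λ ω → ω ∈ A → ω ∈ B)
    →-measurable {A} {B} mA mB = respects (to , from) (∪-measurable (complement mA) mB)
      where
      to : ∁ A ∪ B ⊆ λ ω → ω ∈ A → ω ∈ B
      to (inj₁ ¬a) a = ⊥-elim (¬a a)
      to (inj₂ b)  a = b

      from : (λ ω → ω ∈ A → ω ∈ B) ⊆ ∁ A ∪ B
      from {ω} f with em {ω ∈ A}
      ... | yes a = inj₂ (f a)
      ... | no ¬a = inj₁ ¬a

    ⇔-measurable : ∀ {A B : Event {S}} → Measurable A → Measurable B →
                   Measurable (λ ω → ω ∈ A ⇔ ω ∈ B)
    ⇔-measurable mA mB = respects
      ( (λ (f , g) → record { to = f ; from = g ; to-cong = cong f ; from-cong = cong g })
      , (λ e → Equivalence.to e , Equivalence.from e))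
      (∩-measurable (→-measurable mA mB) (→-measurable mB mA))

    module _ {I : Set} (I↣ℕ : I ↣ ℕ) where
      open Injection I↣ℕ using (to; injective)

      ⋃-measurable : ∀ {A : I → Event {S}} → (∀ i → Measurable (A i)) → Measurable (⋃ I A)
      ⋃-measurable {A} mA = respects
        ((λ (_ , i , _ , a) → i , a) , (λ (i , a) → to i , i , refl , a))
        (union fibre)
        where
        -- By injectivity at most one index has code `n`, so the fibre is a single `A i` or empty.
        fibre : ∀ n → Measurable (λ ω → ∃ λ i → to i ≡ n × ω ∈ A i)
        fibre n with em {∃ λ i → to i ≡ n}
        ... | yes (i , refl) = respects
          ( (λ a → i , refl , a)
          , (λ { (j , eq , a) → subst (λ j → _ ∈ A j) (injective eq) a }))
          (mA i)
        ... | no n∉ = respects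
          ((λ ()) , (λ { (i , eq , _) → n∉ (i , eq) }))
          (const-measurable Empty)

      ⋂-measurable : ∀ {A : I → Event {S}} → (∀ i → Measurable (A i)) → Measurable (⋂ I A)
      ⋂-measurable mA = respects
        ( (λ n i → decidable-stable em λ ¬a → n (i , ¬a))
        , (λ a (i , ¬a) → ¬a (a i)))
        (complement (⋃-measurable (λ i → complement (mA i))))

    -- Recursion on `n`: the union splits in two according to whether the first element belongs to
    -- the subset.
    ∃-Subset-measurable : ∀ {n} {A : Subset n → Event {S}} → (∀ F → Measurable (A F)) →
                          Measurable (⋃ (Subset n) A)
    ∃-Subset-measurable {zero} {A} mA = respects
      ( (λ {ω} → Equivalence.to (∃-Subset-[]-⇔ {P = λ F → ω ∈ A F}))
      , (λ {ω} → Equivalence.from (∃-Subset-[]-⇔ {P = λ F → ω ∈ A F})))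
      (mA [])
    ∃-Subset-measurable {suc n} {A} mA = respects
      ( (λ {ω} → Equivalence.to (∃-Subset-∷-⇔ {P = λ F → ω ∈ A F}))
      , (λ {ω} → Equivalence.from (∃-Subset-∷-⇔ {P = λ F → ω ∈ A F})))
      (∪-measurable (∃-Subset-measurable (λ F → mA (inside ∷ F)))
                    (∃-Subset-measurable (λ F → mA (outside ∷ F))))

    -- Preimages under reindexing commute with every way of building a measurable event, and
    -- coordinate `i` becomes coordinate `g i`. The choice `_+ n` gives measurability of the shift.
    reindex-measurable : ∀ (g : ℕ → ℕ) {A : Event {S}} → Measurable A →
                         Measurable (λ ω → (ω ∘ g) ∈ A)
    reindex-measurable g (coordinate i A)  = coordinate (g i) A
    reindex-measurable g (complement mA)   = complement (reindex-measurable g mA)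
    reindex-measurable g (union mA)        = union (λ i → reindex-measurable g (mA i))
    reindex-measurable g (respects (to , from) mA) =
      respects (to , from) (reindex-measurable g mA)

    cylinder-measurable : ∀ (w : List S) → Measurable (Cylinder w)
    cylinder-measurable []      = U-measurable
    cylinder-measurable (x ∷ w) =
      ∩-measurable (coordinate 0 (_≡ x)) (reindex-measurable suc (cylinder-measurable w))

    𝐅-measurable : ∀ (B : Pred S 0ℓ) → Measurable (𝐅 B)
    𝐅-measurable B = union (λ i → coordinate i B)

  Inf∈-measurable : ∀ {S : Set} {n} (𝓕 : Pred (Subset n) 0ℓ) → Measurable (Inf∈ {S} 𝓕)
  Inf∈-measurable 𝓕 = ∃-Subset-measurable λ F →
    ∩-measurable (const-measurable (F ∈ 𝓕)) (⋂-measurable Fin↣ℕ λ q →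
      ⇔-measurable (const-measurable _)
        (⋂-measurable (↣-id ℕ) λ N → union λ i →
          ∩-measurable (const-measurable (N ℕ.≤ i)) (coordinate i λ x → proj₂ x ≡ q)))
    where
    Fin↣ℕ : ∀ {n} → Fin n ↣ ℕ
    Fin↣ℕ = mk↣ toℕ-injective

-- Probability measures and almost sure events.

module Measure (em : ExcludedMiddle 0ℓ) (ℝ : CompleteOrderedField)
  {S : Set} {P : Event {S} → CompleteOrderedField.Carrier ℝ}
  (isP : Probability.IsProbabilityMeasure ℝ P) where

  open CompleteOrderedField ℝ
  open Probability ℝ
  open OrderedField ℝ
  open Sum em ℝ
  open IsProbabilityMeasure isP
  open ≤-Reasoning

  -- The constant sequence `∅` is pairwise disjoint with union `∅`, so already two of its terms give
  -- `P ∅ + P ∅ ≤ P ∅`.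
  P-∅ : P ∅ ≈ 0#
  P-∅ = ≤-antisym (+-cancelˡ-≤ (P ∅) P∅+P∅≤P∅+0) (nonneg ∅-measurable)
    where
    ∅-measurable : Measurable ∅
    ∅-measurable = const-measurable em Empty

    P-⋃∅ : P (⋃ ℕ λ _ → ∅) ≈ P ∅
    P-⋃∅ = P-cong (union (λ _ → ∅-measurable)) ((λ ()) , (λ ()))

    P∅+P∅≤P∅+0 : P ∅ + P ∅ ≤ P ∅ + 0#
    P∅+P∅≤P∅+0 = begin
      P ∅ + P ∅                     ≈⟨ +-congˡ (+-identityʳ (P ∅)) ⟨
      ∑ (λ _ → P ∅) (0 ∷ 1 ∷ [])    ≤⟨ ∑≤ (σ-additive (λ _ → ∅) (λ _ → ∅-measurable) (λ _ _ _ ()))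
                                          (0 ∷ 1 ∷ []) (((λ ()) All.∷ All.[]) AllPairs.∷ All.[] AllPairs.∷ AllPairs.[]) ⟩
      P (⋃ ℕ λ _ → ∅)               ≈⟨ P-⋃∅ ⟩
      P ∅                           ≈⟨ +-identityʳ (P ∅) ⟨
      P ∅ + 0#                      ∎

  P-empty : ∀ {A} → Measurable A → (∀ ω → ¬ ω ∈ A) → P A ≈ 0#
  P-empty mA empty = ≈-trans (P-cong mA ((λ {ω} → empty ω) , (λ ()))) P-∅

  -- Finite additivity, by padding `A`, `B` with `∅` to a sequence.
  P-∪ : ∀ {A B} → Measurable A → Measurable B → A ⊥ B → P (A ∪ B) ≈ P A + P B
  P-∪ {A} {B} mA mB A⊥B = begin-equality
    P (A ∪ B)          ≈⟨ P-cong (∪-measurable em mA mB) (to , from) ⟩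
    P (⋃ ℕ family)     ≈⟨ HasSum-unique (σ-additive family measurable disjoint)
                            (HasSum-∷ (nonneg mA) (HasSum-∷ (nonneg mB) (HasSum-zero λ _ → P-∅))) ⟩
    P A + (P B + 0#)   ≈⟨ +-congˡ (+-identityʳ (P B)) ⟩
    P A + P B          ∎
    where
    family : ℕ → Event {S}
    family 0             = A
    family 1             = B
    family (suc (suc _)) = ∅

    measurable : ∀ i → Measurable (family i)
    measurable 0             = mA
    measurable 1             = mB
    measurable (suc (suc _)) = const-measurable em Empty

    disjoint : ∀ i j → i ≢ j → family i ⊥ family j
    disjoint 0             0             i≢j _       = i≢j refl
    disjoint 0             1             _   (a , b) = A⊥B (a , b)
    disjoint 0             (suc (suc _)) _   (_ , ())
    disjoint 1             0             _   (b , a) = A⊥B (a , b)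
    disjoint 1             1             i≢j _       = i≢j refl
    disjoint 1             (suc (suc _)) _   (_ , ())
    disjoint (suc (suc _)) _             _   (() , _)

    to : A ∪ B ⊆ ⋃ ℕ family
    to (inj₁ a) = 0 , a
    to (inj₂ b) = 1 , b

    from : ⋃ ℕ family ⊆ A ∪ B
    from (0 , a)           = inj₁ a
    from (1 , b)           = inj₂ b
    from (suc (suc _) , ())

  P-mono : ∀ {A B} → Measurable A → Measurable B → A ⊆ B → P A ≤ P B
  P-mono {A} {B} mA mB A⊆B = begin
    P A                 ≤⟨ x≤x+y (nonneg mB∖A) ⟩
    P A + P (B ∩ ∁ A)   ≈⟨ P-∪ mA mB∖A (λ (a , _ , ¬a) → ¬a a) ⟨
    P (A ∪ (B ∩ ∁ A))   ≈⟨ P-cong (∪-measurable em mA mB∖A) (to , from) ⟩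
    P B                 ∎
    where
    mB∖A : Measurable (B ∩ ∁ A)
    mB∖A = ∩-measurable em mB (complement mA)

    to : A ∪ (B ∩ ∁ A) ⊆ B
    to (inj₁ a)       = A⊆B a
    to (inj₂ (b , _)) = b

    from : B ⊆ A ∪ (B ∩ ∁ A)
    from {ω} b with em {ω ∈ A}
    ... | yes a = inj₁ a
    ... | no ¬a = inj₂ (b , ¬a)

  P-∁ : ∀ {A} → Measurable A → P A + P (∁ A) ≈ 1#
  P-∁ {A} mA = begin-equality
    P A + P (∁ A) ≈⟨ P-∪ mA (complement mA) (λ (a , ¬a) → ¬a a) ⟨
    P (A ∪ ∁ A)   ≈⟨ P-cong (∪-measurable em mA (complement mA)) ((λ _ → tt) , (λ {ω} _ → from ω)) ⟩
    P U           ≈⟨ total ⟩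
    1#            ∎
    where
    from : ∀ ω → ω ∈ A ∪ ∁ A
    from ω with em {ω ∈ A}
    ... | yes a = inj₁ a
    ... | no ¬a = inj₂ ¬a

  P-≤1 : ∀ {A} → Measurable A → P A ≤ 1#
  P-≤1 {A} mA = ≤-trans (x≤x+y (nonneg (complement mA))) (≤-reflexive (P-∁ mA))

  first-measurable : ∀ {A : ℕ → Event {S}} → (∀ n → Measurable (A n)) →
                     ∀ n → Measurable (first em A n)
  first-measurable mA n = ∩-measurable em (mA n) (⋂-measurable em (↣-id ℕ) λ m →
    →-measurable em (const-measurable em (m ℕ.< n)) (complement (mA m)))

  P-⋃-first : ∀ {A : ℕ → Event {S}} → (∀ n → Measurable (A n)) →
              HasSum (λ n → P (first em A n)) (P (⋃ ℕ (first em A)))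
  P-⋃-first {A} mA = σ-additive (first em A) (first-measurable mA) (first-disjoint em A)

  -- After disjointification the measure of the union is the sum of a series whose terms are at most
  -- `P (A n)`, hence all zero.
  P-⋃-null : ∀ {A : ℕ → Event {S}} → (∀ n → Measurable (A n)) → (∀ n → P (A n) ≈ 0#) →
             P (⋃ ℕ A) ≈ 0#
  P-⋃-null {A} mA null = ≈-trans
    (P-cong (union mA) (proj₂ (⋃-first em A) , proj₁ (⋃-first em A)))
    (HasSum-unique (P-⋃-first mA) (HasSum-zero λ n → ≤-antisym
      (≤-trans (P-mono (first-measurable mA n) (mA n) proj₁) (≤-reflexive (null n)))
      (nonneg (first-measurable mA n))))

  -- Measurability is bundled in because the value of `P` carries no meaning on other events.
  record AlmostSure (A : Event {S}) : Set₁ where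
    constructor almostSure
    field
      measurable  : Measurable A
      probability : P A ≈ 1#
  open AlmostSure

  null⇒almostSure : ∀ {A} → Measurable A → P A ≈ 0# → AlmostSure (∁ A)
  null⇒almostSure {A} mA null = almostSure (complement mA) (begin-equality
    P (∁ A)       ≈⟨ +-identityˡ _ ⟨
    0# + P (∁ A)  ≈⟨ +-congʳ null ⟨
    P A + P (∁ A) ≈⟨ P-∁ mA ⟩
    1#            ∎)

  almostSure⇒null : ∀ {A} → AlmostSure A → P (∁ A) ≈ 0#
  almostSure⇒null {A} as = +-cancelˡ 1# (begin-equality
    1# + P (∁ A)  ≈⟨ +-congʳ (probability as) ⟨
    P A + P (∁ A) ≈⟨ P-∁ (measurable as) ⟩
    1#            ≈⟨ +-identityʳ 1# ⟨
    1# + 0#       ∎)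

  almostSure-⊆ : ∀ {A B} → AlmostSure A → Measurable B → A ⊆ B → AlmostSure B
  almostSure-⊆ as mB A⊆B = almostSure mB (≤-antisym (P-≤1 mB)
    (≤-trans (≤-reflexive (≈-sym (probability as))) (P-mono (measurable as) mB A⊆B)))

  almostSure-U : AlmostSure U
  almostSure-U = almostSure (U-measurable em) total

  almostSure-⋂ : ∀ {I : Set} → I ↣ ℕ → ∀ {A : I → Event {S}} → (∀ i → AlmostSure (A i)) →
                 AlmostSure (⋂ I A)
  almostSure-⋂ {I} I↣ℕ {A} as = almostSure-⊆
    (null⇒almostSure (union (complement ∘ measurable ∘ fibre))
      (P-⋃-null (complement ∘ measurable ∘ fibre) (almostSure⇒null ∘ fibre)))
    (⋂-measurable em I↣ℕ (measurable ∘ as))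
    (λ n i → decidable-stable em λ ¬a → n (to i , λ f → ¬a (f i refl)))
    where
    open Injection I↣ℕ using (to; injective)

    -- The conditions are re-indexed by their codes; at an `n` that codes no index the condition is
    -- vacuous.
    fibre : ∀ n → AlmostSure (λ ω → ∀ i → to i ≡ n → ω ∈ A i)
    fibre n with em {∃ λ i → to i ≡ n}
    ... | yes (i , refl) = almostSure-⊆ (as i)
      (respects
        ( (λ a j eq → subst (λ j → _ ∈ A j) (sym (injective eq)) a)
        , (λ f → f i refl)) (measurable (as i)))
      (λ a j eq → subst (λ j → _ ∈ A j) (sym (injective eq)) a)
    ... | no n∉ = almostSure-⊆ almostSure-U
      (respects ((λ _ i eq → ⊥-elim (n∉ (i , eq))) , (λ _ → tt)) (U-measurable em))
      (λ _ i eq → ⊥-elim (n∉ (i , eq)))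

  almostSure-∩ : ∀ {A B} → AlmostSure A → AlmostSure B → AlmostSure (A ∩ B)
  almostSure-∩ {A} {B} asA asB = almostSure-⊆ (almostSure-⋂ (↣-id ℕ) family)
    (∩-measurable em (measurable asA) (measurable asB))
    (λ f → f 0 , f 1)
    where
    events : ℕ → Event {S}
    events zero    = A
    events (suc _) = B

    family : ∀ i → AlmostSure (events i)
    family zero    = asA
    family (suc _) = asB

  -- The passage from probabilities to a single path: were the intersection empty, `B` would lie in
  -- the null complement of `A`.
  almostSure-meets : ∀ {A B} → AlmostSure A → Measurable B → 0# < P B → ∃ (A ∩ B)
  almostSure-meets {A} {B} as mB (_ , 0≉PB) = decidable-stable em λ none →
    0≉PB (≤-antisym (nonneg mB) (≤-trans
      (P-mono mB (complement (measurable as)) (λ b a → none (_ , a , b)))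
      (≤-reflexive (almostSure⇒null as))))

  -- Total probability over the state at time `n`. The pieces are first indexed by codes, where
  -- those outside the image are empty.
  P-partition : S ↣ ℕ → ∀ n {E} → Measurable E → HasSum (λ s → P (λ ω → ω ∈ E × ω n ≡ s)) (P E)
  P-partition S↣ℕ n {E} mE = HasSum-cong
    (λ s → P-cong (mpiece (to s))
      ((λ (e , eq) → e , injective eq) , (λ (e , eq) → e , cong to eq)))
    (HasSum-↣ S↣ℕ (λ i i∉ → P-empty (mpiece i) λ ω (_ , eq) → i∉ (ω n , eq)) pieces)
    where
    open Injection S↣ℕ using (to; injective)

    piece : ℕ → Event {S}
    piece i ω = ω ∈ E × to (ω n) ≡ i

    mpiece : ∀ i → Measurable (piece i)
    mpiece i = ∩-measurable em mE (coordinate n (λ s → to s ≡ i))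

    P-⋃-piece : P (⋃ ℕ piece) ≈ P E
    P-⋃-piece = P-cong (union mpiece) ((λ (_ , e , _) → e) , (λ e → _ , e , refl))

    pieces : HasSum (λ i → P (piece i)) (P E)
    pieces = HasSum-resp P-⋃-piece (σ-additive piece mpiece
      λ i j i≢j ((_ , eq) , (_ , eq′)) → i≢j (trans (sym eq) eq′))

  -- `R` is an accumulator: each step of the induction on the list moves one `W i` into it.
  ∑-disjoint : ∀ {W : ℕ → Event {S}} → (∀ i → Measurable (W i)) → (∀ i j → i ≢ j → W i ⊥ W j) →
               ∀ l → Unique l → ∀ {R X} → Measurable R → Measurable X → R ⊆ X → All (λ i → W i ⊆ X) l →
               All (λ i → R ⊥ W i) l → P R + ∑ (λ i → P (W i)) l ≤ P X
  ∑-disjoint mW disj [] _ mR mX R⊆X _ _ = ≤-trans (≤-reflexive (+-identityʳ _)) (P-mono mR mX R⊆X)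
  ∑-disjoint {W} mW disj (i ∷ l) (i∉ AllPairs.∷ u) {R} {X} mR mX R⊆X (Wi⊆X All.∷ Wl⊆X) (R⊥Wi All.∷ R⊥Wl) = begin
    P R + (P (W i) + ∑ (λ i → P (W i)) l) ≈⟨ +-assoc _ _ _ ⟨
    P R + P (W i) + ∑ (λ i → P (W i)) l   ≈⟨ +-congʳ (P-∪ mR (mW i) R⊥Wi) ⟨
    P (R ∪ W i) + ∑ (λ i → P (W i)) l     ≤⟨ ∑-disjoint mW disj l u (∪-measurable em mR (mW i)) mX
                                               (λ { (inj₁ r) → R⊆X r ; (inj₂ w) → Wi⊆X w }) Wl⊆X
                                               (All.zipWith (λ { (R⊥Wj , i≢j) (inj₁ r , w) → R⊥Wj (r , w)
                                                               ; (R⊥Wj , i≢j) (inj₂ v , w) → disj i _ i≢j (v , w) })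
                                                            (R⊥Wl , i∉)) ⟩
    P X                                   ∎

  -- The tail of a convergent series, without limits. A finite list of indices lies below some `K`,
  -- so its events are disjoint from the tail at `K`, and its sum plus `δ` is at most the total `s`.
  -- Taking the supremum over lists gives `δ + s ≤ s`.
  tail-vanishes : ∀ {W : ℕ → Event {S}} → (∀ i → Measurable (W i)) → (∀ i j → i ≢ j → W i ⊥ W j) →
                  ∀ {δ} → (∀ K → δ ≤ P (λ ω → ∃[ i ] K ℕ.≤ i × ω ∈ W i)) → δ ≤ 0#
  tail-vanishes {W} mW disj {δ} bound = +-cancelˡ-≤ s (begin
    s + δ                 ≈⟨ +-comm s δ ⟩
    δ + s                 ≤⟨ y≤-x+z⇒x+y≤z (sum-least sum _ λ l u → x+y≤z⇒y≤-x+z (δ+∑≤s l u)) ⟩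
    s                     ≈⟨ +-identityʳ s ⟨
    s + 0#                ∎)
    where
    s : Carrier
    s = P (⋃ ℕ W)

    sum : HasSum (λ i → P (W i)) s
    sum = σ-additive W mW disj

    upper : ∀ (l : List ℕ) → ∃ λ K → All (ℕ._< K) l
    upper []      = 0 , All.[]
    upper (i ∷ l) with upper l
    ... | K , l<K = suc i ℕ.⊔ K , ℕ.m≤m⊔n (suc i) K All.∷ All.map (λ j<K → ℕ.<-≤-trans j<K (ℕ.m≤n⊔m (suc i) K)) l<K

    δ+∑≤s : ∀ l → Unique l → δ + ∑ (λ i → P (W i)) l ≤ s
    δ+∑≤s l u with upper l
    ... | K , l<K = ≤-trans (+-monoˡ-≤ _ (bound K)) (∑-disjoint mW disj l u
      (union λ i → ∩-measurable em (const-measurable em (K ℕ.≤ i)) (mW i)) (union mW)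
      (λ (i , _ , w) → i , w) (All.universal (λ i {_} w → i , w) l)
      (All.map (λ { j<K ((i , K≤i , w) , w′) → disj i _ (ℕ.>⇒≢ (ℕ.<-≤-trans j<K K≤i)) (w , w′) }) l<K))

-- Shifts, cylinders and infinitely frequent visits.

module _ {S : Set} where

  -- With `i + n` in this order, `shift n ω 0` reduces to `ω n`, and a transition of the shifted
  -- path at `i` reduces to one of `ω` at `i + n`.
  shift : ℕ → (ℕ → S) → (ℕ → S)
  shift n ω i = ω (i ℕ.+ n)

  -- Does the work of function extensionality: `shift 0 ω` and `ω`, for instance, agree only
  -- pointwise.
  cylinder-cong : ∀ w {ω ω′ : ℕ → S} → (∀ i → ω i ≡ ω′ i) → ω ∈ Cylinder w → ω′ ∈ Cylinder w
  cylinder-cong []      eq _       = tt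
  cylinder-cong (x ∷ w) eq (e , c) = trans (sym (eq 0)) e , cylinder-cong w (eq ∘ suc) c

  cylinder-++ : ∀ u v → Cylinder (u ++ v) ≐ λ ω → ω ∈ Cylinder u × shift (length u) ω ∈ Cylinder v
  cylinder-++ u v = (λ {ω} → to u ω) , (λ {ω} (c , d) → from u ω c d)
    where
    to : ∀ u ω → ω ∈ Cylinder (u ++ v) → ω ∈ Cylinder u × shift (length u) ω ∈ Cylinder v
    to []      ω c       = tt , cylinder-cong v (λ i → cong ω (sym (ℕ.+-identityʳ i))) c
    to (x ∷ u) ω (e , c) with to u (ω ∘ suc) c
    ... | d , f = (e , d) , cylinder-cong v (λ i → cong ω (sym (ℕ.+-suc i (length u)))) f

    from : ∀ u ω → ω ∈ Cylinder u → shift (length u) ω ∈ Cylinder v → ω ∈ Cylinder (u ++ v)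
    from []      ω _       f = cylinder-cong v (λ i → cong ω (ℕ.+-identityʳ i)) f
    from (x ∷ u) ω (e , c) f =
      e , from u (ω ∘ suc) c (cylinder-cong v (λ i → cong ω (ℕ.+-suc i (length u))) f)

  cylinder-∷ʳ : ∀ u x → Cylinder (u ∷ʳ x) ≐ λ ω → ω ∈ Cylinder u × ω (length u) ≡ x
  cylinder-∷ʳ u x =
    (λ c → proj₁ (proj₁ (cylinder-++ u (x ∷ [])) c) , proj₁ (proj₂ (proj₁ (cylinder-++ u (x ∷ [])) c))) ,
    (λ (c , e) → proj₂ (cylinder-++ u (x ∷ [])) (c , e , tt))

  cylinder-agree : ∀ u {ω ω′ : ℕ → S} → ω ∈ Cylinder u → ω′ ∈ Cylinder u →
                   ∀ i → i ℕ.< length u → ω i ≡ ω′ i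
  cylinder-agree (x ∷ u) (e , _) (e′ , _) zero    _           = trans e (sym e′)
  cylinder-agree (x ∷ u) (_ , c) (_ , c′) (suc i) (ℕ.s≤s i<n) = cylinder-agree u c c′ i i<n

  -- Stands for membership in the σ-algebra generated by the coordinates up to and including `n`.
  Adapted : ℕ → Event {S} → Set
  Adapted n A = ∀ {ω ω′} → (∀ i → i ℕ.≤ n → ω i ≡ ω′ i) → ω ∈ A → ω′ ∈ A

  InfinitelyOften : S → Event {S}
  InfinitelyOften x ω = ∀ N → ∃[ i ] N ℕ.≤ i × ω i ≡ x

  infinitelyOften-shift : ∀ N {x} {ω : ℕ → S} → ω ∈ InfinitelyOften x → shift N ω ∈ InfinitelyOften x
  infinitelyOften-shift N {ω = ω} io M with io (M ℕ.+ N)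
  ... | i , M+N≤i , e =
    i ℕ.∸ N , ℕ.m+n≤o⇒m≤o∸n M M+N≤i , trans (cong ω (ℕ.m∸n+n≡m (ℕ.m+n≤o⇒n≤o M M+N≤i))) e

  Transition : S → S → ℕ → Event {S}
  Transition x y i ω = ω i ≡ x × ω (suc i) ≡ y

  infinitelyOften-measurable : ExcludedMiddle 0ℓ → ∀ x → Measurable (InfinitelyOften x)
  infinitelyOften-measurable em x = ⋂-measurable em (↣-id ℕ) λ N → union λ i →
    ∩-measurable em (const-measurable em (N ℕ.≤ i)) (coordinate i (_≡ x))

  transition-measurable : ExcludedMiddle 0ℓ → ∀ x y i → Measurable (Transition x y i)
  transition-measurable em x y i = ∩-measurable em (coordinate i (_≡ x)) (coordinate (suc i) (_≡ y))

-- If the head `b` is not seen from some time `M` on, every visit to the list after `M` is a visit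
-- to its tail.
pigeonhole : ExcludedMiddle 0ℓ → ∀ {S : Set} (B : List S) {ω : ℕ → S} →
             (∀ N → ∃[ i ] N ℕ.≤ i × ω i ∈ˡ B) → ∃[ b ] b ∈ˡ B × ω ∈ InfinitelyOften b
pigeonhole em []      often with _ , _ , () ← often 0
pigeonhole em (b ∷ B) {ω} often with em {ω ∈ InfinitelyOften b}
... | yes io = b , here refl , io
... | no ¬io with ¬∀⇒∃¬ em ¬io
... | M , none = let b′ , b′∈B , io = pigeonhole em B often′ in b′ , there b′∈B , io
  where
  often′ : ∀ N → ∃[ i ] N ℕ.≤ i × ω i ∈ˡ B
  often′ N with often (M ℕ.⊔ N)
  ... | i , M⊔N≤i , here e  = ⊥-elim (none (i , ℕ.m⊔n≤o⇒m≤o M N M⊔N≤i , e))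
  ... | i , M⊔N≤i , there m = i , ℕ.m⊔n≤o⇒n≤o M N M⊔N≤i , m

-- Maximality is relative to the list `l`, which shrinks in the recursion, while the witness stays
-- in the fixed `B`.
maximal-above : ExcludedMiddle 0ℓ → ∀ {S : Set} {_⊑_ : Rel S 0ℓ} →
  (∀ {x} → x ⊑ x) → (∀ {x y z} → x ⊑ y → y ⊑ z → x ⊑ z) →
  ∀ {B : Pred S 0ℓ} l → (∀ {x} → x ∈ˡ l → x ∈ B) → ∀ {b} → b ∈ B →
  ∃[ c ] c ∈ B × b ⊑ c × (∀ {d} → d ∈ˡ l → c ⊑ d → d ⊑ c)
maximal-above em reflexive transitive []      l⊆B b∈B = _ , b∈B , reflexive , λ ()
maximal-above em {_⊑_ = _⊑_} reflexive transitive (d ∷ l) l⊆B b∈B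
  with maximal-above em {_⊑_ = _⊑_} reflexive transitive l (l⊆B ∘ there) b∈B
... | c , c∈B , b⊑c , c-max with em {c ⊑ d}
... | no c⋢d = c , c∈B , b⊑c , λ where
  (here refl) c⊑d → ⊥-elim (c⋢d c⊑d)
  (there e)   c⊑e → c-max e c⊑e
-- If `d` is above `c`, the search restarts from `d`: the new element is above `d`, hence also
-- maximal with respect to `d`.
... | yes c⊑d with maximal-above em {_⊑_ = _⊑_} reflexive transitive l (l⊆B ∘ there) (l⊆B (here refl))
... | c′ , c′∈B , d⊑c′ , c′-max = c′ , c′∈B , transitive b⊑c (transitive c⊑d d⊑c′) , λ where
  (here refl) _    → d⊑c′
  (there e)   c′⊑e → c′-max e c′⊑e

-- The Markov property and recurrence.

module Chain (em : ExcludedMiddle 0ℓ) (ℝ : CompleteOrderedField) {S : Set} {k : ℕ}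
  (𝓣 : Probability.LabelledMarkovChain ℝ S k) where

  open CompleteOrderedField ℝ
  open Probability ℝ
  open OrderedField ℝ
  open Sum em ℝ
  open LabelledMarkovChain 𝓣
  open ≤-Reasoning

  transitions-nonneg : ∀ x w → 0# ≤ transitions 𝓣 x w
  transitions-nonneg x []      = 0≤1
    where
    0≤1 : 0# ≤ 1#
    0≤1 = ≤-trans (0≤x*x 1#) (≤-reflexive (*-identityˡ 1#))
  transitions-nonneg x (y ∷ w) = *-nonneg (Dist.nonneg (κ x) y) (transitions-nonneg y w)

  transitions-++ : ∀ y u x w → transitions 𝓣 y (u ++ x ∷ w) ≈ transitions 𝓣 y (u ∷ʳ x) * transitions 𝓣 x w
  transitions-++ y []      x w = *-congʳ (≈-sym (*-identityʳ _))
  transitions-++ y (z ∷ u) x w = ≈-trans (*-congˡ (transitions-++ z u x w)) (≈-sym (*-assoc _ _ _))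

  module Law {μ : Dist S} {P : Event {S} → Carrier} (law : IsLaw 𝓣 μ P) where
    open IsLaw law
    open IsProbabilityMeasure isProbabilityMeasure
    open Measure em ℝ isProbabilityMeasure
    open AlmostSure

    P-cylinder-++ : ∀ u x w → P (Cylinder (u ++ x ∷ w)) ≈ P (Cylinder (u ∷ʳ x)) * transitions 𝓣 x w
    P-cylinder-++ [] x w = begin-equality
      P (Cylinder (x ∷ w))                           ≈⟨ cylinder x w ⟩
      mass μ x * transitions 𝓣 x w                   ≈⟨ *-congʳ (*-identityʳ _) ⟨
      mass μ x * 1# * transitions 𝓣 x w              ≈⟨ *-congʳ (cylinder x []) ⟨
      P (Cylinder (x ∷ [])) * transitions 𝓣 x w      ∎
    P-cylinder-++ (y ∷ u) x w = begin-equality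
      P (Cylinder (y ∷ u ++ x ∷ w))                                ≈⟨ cylinder y (u ++ x ∷ w) ⟩
      mass μ y * transitions 𝓣 y (u ++ x ∷ w)                      ≈⟨ *-congˡ (transitions-++ y u x w) ⟩
      mass μ y * (transitions 𝓣 y (u ∷ʳ x) * transitions 𝓣 x w)    ≈⟨ *-assoc _ _ _ ⟨
      mass μ y * transitions 𝓣 y (u ∷ʳ x) * transitions 𝓣 x w      ≈⟨ *-congʳ (cylinder y (u ∷ʳ x)) ⟨
      P (Cylinder (y ∷ u ∷ʳ x)) * transitions 𝓣 x w                ∎

    module _ (n : ℕ) {A : Event {S}} (mA : Measurable A) (adapted : Adapted n A) (x : S) (w : List S) where

      Now Later : Event {S}
      Now   ω = ω ∈ A × ω n ≡ x
      Later ω = ω ∈ A × shift n ω ∈ Cylinder (x ∷ w)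

      now-measurable : Measurable Now
      now-measurable = ∩-measurable em mA (coordinate n (_≡ x))

      later-measurable : Measurable Later
      later-measurable = ∩-measurable em mA (reindex-measurable em (ℕ._+ n) (cylinder-measurable em (x ∷ w)))

      -- Induction on the number m of coordinates below n left free by u: on a
      -- cylinder which fixes the coordinates 0, …, n, the adapted event A is
      -- all or nothing.
      markov-within : ∀ m u → m ℕ.+ length u ≡ n →
                      P (Cylinder u ∩ Later) ≈ P (Cylinder u ∩ Now) * transitions 𝓣 x w
      markov-within zero u refl with em {∃ (Cylinder (u ∷ʳ x) ∩ A)}
      ... | yes (ω₀ , c₀ , a₀) = begin-equality
        P (Cylinder u ∩ Later)                           ≈⟨ P-cong (∩-measurable em (cylinder-measurable em u) later-measurable)
                                                              ( (λ (c , _ , d) → proj₂ (cylinder-++ u (x ∷ w)) (c , d))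
                                                              , (λ {ω} c → let c′ , d = proj₁ (cylinder-++ u (x ∷ w)) c
                                                                           in c′ , within ω (proj₂ (cylinder-∷ʳ u x) (c′ , proj₁ d)) , d)) ⟩
        P (Cylinder (u ++ x ∷ w))                        ≈⟨ P-cylinder-++ u x w ⟩
        P (Cylinder (u ∷ʳ x)) * transitions 𝓣 x w        ≈⟨ *-congʳ (P-cong (cylinder-measurable em (u ∷ʳ x))
                                                              ( (λ {ω} c → let c′ , e = proj₁ (cylinder-∷ʳ u x) c in c′ , within ω c , e)
                                                              , (λ (c , _ , e) → proj₂ (cylinder-∷ʳ u x) (c , e)))) ⟩
        P (Cylinder u ∩ Now) * transitions 𝓣 x w         ∎
        where
        within : ∀ ω → ω ∈ Cylinder (u ∷ʳ x) → ω ∈ A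
        within ω c = adapted (λ i i≤n → cylinder-agree (u ∷ʳ x) c₀ c i (ℕ.≤-<-trans i≤n
          (ℕ.≤-reflexive (sym (trans (length-++ u) (ℕ.+-comm (length u) 1)))))) a₀
      ... | no none = begin-equality
        P (Cylinder u ∩ Later)                    ≈⟨ P-empty (∩-measurable em (cylinder-measurable em u) later-measurable)
                                                       (λ ω (c , a , e , _) → none (ω , proj₂ (cylinder-∷ʳ u x) (c , e) , a)) ⟩
        0#                                        ≈⟨ zeroˡ _ ⟨
        0# * transitions 𝓣 x w                    ≈⟨ *-congʳ (P-empty (∩-measurable em (cylinder-measurable em u) now-measurable)
                                                       (λ ω (c , a , e) → none (ω , proj₂ (cylinder-∷ʳ u x) (c , e) , a))) ⟨
        P (Cylinder u ∩ Now) * transitions 𝓣 x w  ∎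
      markov-within (suc m) u m+u≡n = HasSum-unique
        (P-partition countable (length u) (∩-measurable em (cylinder-measurable em u) later-measurable))
        (HasSum-cong (λ s → ≈-sym (begin-equality
          P (λ ω → (ω ∈ Cylinder u × ω ∈ Later) × ω (length u) ≡ s)  ≈⟨ P-cong (extend-measurable later-measurable s) (extend s) ⟩
          P (Cylinder (u ∷ʳ s) ∩ Later)                              ≈⟨ markov-within m (u ∷ʳ s) (m+us≡n s) ⟩
          P (Cylinder (u ∷ʳ s) ∩ Now) * transitions 𝓣 x w            ≈⟨ *-congʳ (P-cong (extend-measurable now-measurable s) (extend s)) ⟨
          P (λ ω → (ω ∈ Cylinder u × ω ∈ Now) × ω (length u) ≡ s) * transitions 𝓣 x w ∎))
          (HasSum-*ʳ (transitions-nonneg x w)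
            (P-partition countable (length u) (∩-measurable em (cylinder-measurable em u) now-measurable))))
        where
        extend-measurable : ∀ {E} → Measurable E → ∀ s →
                            Measurable (λ ω → (ω ∈ Cylinder u × ω ∈ E) × ω (length u) ≡ s)
        extend-measurable mE s = ∩-measurable em (∩-measurable em (cylinder-measurable em u) mE) (coordinate (length u) (_≡ s))

        extend : ∀ {E : Event {S}} s → (λ ω → (ω ∈ Cylinder u × ω ∈ E) × ω (length u) ≡ s) ≐ (Cylinder (u ∷ʳ s) ∩ E)
        extend s = (λ ((c , e) , eq) → proj₂ (cylinder-∷ʳ u s) (c , eq) , e)
                 , (λ (c , e) → let c′ , eq = proj₁ (cylinder-∷ʳ u s) c in (c′ , e) , eq)

        m+us≡n : ∀ s → m ℕ.+ length (u ∷ʳ s) ≡ n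
        m+us≡n s = trans (cong (m ℕ.+_) (trans (length-++ u) (ℕ.+-comm (length u) 1)))
                         (trans (ℕ.+-suc m (length u)) m+u≡n)

      markov : P Later ≈ P Now * transitions 𝓣 x w
      markov = begin-equality
        P Later                                   ≈⟨ P-cong later-measurable ((λ a → tt , a) , proj₂) ⟩
        P (Cylinder [] ∩ Later)                   ≈⟨ markov-within n [] (ℕ.+-identityʳ n) ⟩
        P (Cylinder [] ∩ Now) * transitions 𝓣 x w ≈⟨ *-congʳ (P-cong now-measurable ((λ a → tt , a) , proj₂)) ⟨
        P Now * transitions 𝓣 x w                 ∎

    markov-step : ∀ n {A} → Measurable A → Adapted n A → ∀ x y →
                  P (λ ω → ω ∈ A × ω ∈ Transition x y n) ≈ P (λ ω → ω ∈ A × ω n ≡ x) * mass (κ x) y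
    markov-step n {A} mA adapted x y = begin-equality
      P (λ ω → ω ∈ A × ω ∈ Transition x y n)              ≈⟨ P-cong (∩-measurable em mA (transition-measurable em x y n))
                                                               ((λ (a , e , f) → a , e , f , tt) , (λ (a , e , f , _) → a , e , f)) ⟩
      P (Later n mA adapted x (y ∷ []))                   ≈⟨ markov n mA adapted x (y ∷ []) ⟩
      P (λ ω → ω ∈ A × ω n ≡ x) * (mass (κ x) y * 1#)     ≈⟨ *-congˡ (*-identityʳ _) ⟩
      P (λ ω → ω ∈ A × ω n ≡ x) * mass (κ x) y            ∎

    shifted : ℕ → Event {S} → Carrier
    shifted n A = P (λ ω → shift n ω ∈ A)

    marginal : ℕ → Dist S
    marginal n = record
      { mass   = λ s → P (λ ω → ω n ≡ s)
      ; nonneg = λ s → nonneg (coordinate n (_≡ s))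
      ; total  = HasSum-cong
          (λ s → P-cong (∩-measurable em (U-measurable em) (coordinate n (_≡ s))) (proj₂ , (λ e → tt , e)))
          (HasSum-resp total (P-partition countable n (U-measurable em)))
      }

    -- The cylinder formula for the shifted measure is `markov` with the trivial past event `U`.
    shifted-isLaw : ∀ n → IsLaw 𝓣 (marginal n) (shifted n)
    shifted-isLaw n = record
      { isProbabilityMeasure = record
        { nonneg     = λ mA → nonneg (reindex-measurable em (ℕ._+ n) mA)
        ; P-cong     = λ mA (to , from) → P-cong (reindex-measurable em (ℕ._+ n) mA) (to , from)
        ; total      = total
        ; σ-additive = λ A mA disj → σ-additive (λ i ω → shift n ω ∈ A i) (λ i → reindex-measurable em (ℕ._+ n) (mA i))
                         (λ i j i≢j → disj i j i≢j)
        }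
      ; cylinder = λ x w → begin-equality
          P (λ ω → shift n ω ∈ Cylinder (x ∷ w))    ≈⟨ P-cong (reindex-measurable em (ℕ._+ n) (cylinder-measurable em (x ∷ w)))
                                                         ((λ c → tt , c) , proj₂) ⟩
          P (Later n (U-measurable em) (λ _ _ → tt) x w)  ≈⟨ markov n (U-measurable em) (λ _ _ → tt) x w ⟩
          P (Now n (U-measurable em) (λ _ _ → tt) x w) * transitions 𝓣 x w
            ≈⟨ *-congʳ (P-cong (now-measurable n (U-measurable em) (λ _ _ → tt) x w) (proj₂ , (λ e → tt , e))) ⟩
          P (λ ω → ω n ≡ x) * transitions 𝓣 x w     ∎
      }

    -- Let p = κ x y and let H be the event below.  On H, for every K there is a
    -- first visit to x at a time ≥ K that no transition from x to y precedes.
    -- Such a visit is followed by y with probability p, in which case the first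
    -- transition from x to y happens at a time ≥ K.  So p * P H is at most the
    -- probability of the latter, which tends to 0 as K grows.
    recurrence-null : ∀ x y → 0# < mass (κ x) y →
                      P (λ ω → ω ∈ InfinitelyOften x × (∀ i → ¬ ω ∈ Transition x y i)) ≈ 0#
    recurrence-null x y (_ , 0≉p) = x*y≈0⇒x≈0
      (≤-antisym
        (tail-vanishes first-T-measurable (first-disjoint em T) PH*p≤tail)
        (*-nonneg (nonneg H-measurable) 0≤p))
      (λ p≈0 → 0≉p (≈-sym p≈0))
      where
      p : Carrier
      p = mass (κ x) y

      0≤p : 0# ≤ p
      0≤p = Dist.nonneg (κ x) y

      T : ℕ → Event {S}
      T = Transition x y

      H : Event {S}
      H ω = ω ∈ InfinitelyOften x × (∀ i → ¬ ω ∈ T i)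

      H-measurable : Measurable H
      H-measurable = ∩-measurable em (infinitelyOften-measurable em x)
        (⋂-measurable em (↣-id ℕ) λ i → complement (transition-measurable em x y i))

      first-T-measurable : ∀ i → Measurable (first em T i)
      first-T-measurable = first-measurable (transition-measurable em x y)

      Fresh : ℕ → Event {S}
      Fresh m ω = ∀ j → j ℕ.< m → ¬ ω ∈ T j

      V : ℕ → ℕ → Event {S}
      V K m ω = (K ℕ.≤ m × ω m ≡ x) × ω ∈ Fresh m

      V-measurable : ∀ K m → Measurable (V K m)
      V-measurable K m = ∩-measurable em
        (∩-measurable em (const-measurable em (K ℕ.≤ m)) (coordinate m (_≡ x)))
        (⋂-measurable em (↣-id ℕ) λ j → →-measurable em (const-measurable em (j ℕ.< m))
          (complement (transition-measurable em x y j)))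

      V-adapted : ∀ K m → Adapted m (V K m)
      V-adapted K m eq ((K≤m , e) , fresh) =
        (K≤m , trans (sym (eq m ℕ.≤-refl)) e) ,
        -- `T j` also reads time `suc j`; `j < m` is by definition `suc j ≤ m`, so nothing later
        -- than `m` is read.
        λ j j<m (e₁ , e₂) → fresh j j<m (trans (eq j (ℕ.<⇒≤ j<m)) e₁ , trans (eq (suc j) j<m) e₂)

      firstV-adapted : ∀ K m → Adapted m (first em (V K) m)
      firstV-adapted K m eq (v , none) = V-adapted K m eq v ,
        λ j j<m v′ → none j j<m (V-adapted K j (λ i i≤j → sym (eq i (ℕ.≤-trans i≤j (ℕ.<⇒≤ j<m)))) v′)

      Hit : ℕ → ℕ → Event {S}
      Hit K m ω = ω ∈ first em (V K) m × ω ∈ T m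

      hit-measurable : ∀ K m → Measurable (Hit K m)
      hit-measurable K m = ∩-measurable em (first-measurable (V-measurable K) m) (transition-measurable em x y m)

      P-hit : ∀ K m → P (Hit K m) ≈ P (first em (V K) m) * p
      P-hit K m = ≈-trans
        (markov-step m (first-measurable (V-measurable K) m) (firstV-adapted K m) x y)
        (*-congʳ (P-cong (∩-measurable em (first-measurable (V-measurable K) m) (coordinate m (_≡ x)))
          (proj₁ , (λ v → v , proj₂ (proj₁ (proj₁ v))))))

      P-⋃-hit : ∀ K → P (⋃ ℕ (first em (V K))) * p ≈ P (⋃ ℕ (Hit K))
      P-⋃-hit K = HasSum-unique
        (HasSum-*ʳ 0≤p (P-⋃-first (V-measurable K)))
        (HasSum-cong (P-hit K) (σ-additive (Hit K) (hit-measurable K)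
          λ i j i≢j ((v , _) , (v′ , _)) → first-disjoint em (V K) i j i≢j (v , v′)))

      PH*p≤tail : ∀ K → P H * p ≤ P (λ ω → ∃[ i ] K ℕ.≤ i × ω ∈ first em T i)
      PH*p≤tail K = begin
        P H * p                                          ≤⟨ *-monoʳ-≤ 0≤p (P-mono H-measurable (union (first-measurable (V-measurable K))) H⊆V) ⟩
        P (⋃ ℕ (first em (V K))) * p                     ≈⟨ P-⋃-hit K ⟩
        P (⋃ ℕ (Hit K))                                  ≤⟨ P-mono (union (hit-measurable K))
                                                              (union λ i → ∩-measurable em (const-measurable em (K ℕ.≤ i)) (first-T-measurable i))
                                                              (λ (m , (((K≤m , _) , fresh) , _) , t) → m , K≤m , t , fresh) ⟩
        P (λ ω → ∃[ i ] K ℕ.≤ i × ω ∈ first em T i)      ∎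
        where
        H⊆V : H ⊆ ⋃ ℕ (first em (V K))
        H⊆V (io , never) with io K
        ... | m , K≤m , e = least em (m , (K≤m , e) , λ j _ → never j)

  module _ {μ : Dist S} {P : Event {S} → Carrier} (law : IsLaw 𝓣 μ P) where
    open IsLaw law
    open IsProbabilityMeasure isProbabilityMeasure
    open Law law
    open Measure em ℝ isProbabilityMeasure

    almostSure-recurrence : AlmostSure λ ω → ∀ x y N →
      0# < mass (κ x) y → ω ∈ InfinitelyOften x → ∃[ i ] N ℕ.≤ i × ω ∈ Transition x y i
    almostSure-recurrence =
      almostSure-⋂ countable λ x → almostSure-⋂ countable λ y → almostSure-⋂ (↣-id ℕ) λ N → recur x y N
      where
      recur : ∀ x y N → AlmostSure λ ω →
        0# < mass (κ x) y → ω ∈ InfinitelyOften x → ∃[ i ] N ℕ.≤ i × ω ∈ Transition x y i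
      recur x y N with em {0# < mass (κ x) y}
      ... | no 0≮p = almostSure-⊆ almostSure-U
        (respects ((λ _ 0<p → ⊥-elim (0≮p 0<p)) , (λ _ → tt)) (U-measurable em))
        (λ _ 0<p → ⊥-elim (0≮p 0<p))
      ... | yes 0<p = almostSure-⊆
        (null⇒almostSure
          (reindex-measurable em (ℕ._+ N) (∩-measurable em (infinitelyOften-measurable em x)
            (⋂-measurable em (↣-id ℕ) λ i → complement (transition-measurable em x y i))))
          -- `recurrence-null` only yields some transition; under the law shifted by `N` it yields
          -- one at a time at least `N`.
          (Law.recurrence-null (shifted-isLaw N) x y 0<p))
        (→-measurable em (const-measurable em _) (→-measurable em (infinitelyOften-measurable em x)
          (union λ i → ∩-measurable em (const-measurable em (N ℕ.≤ i)) (transition-measurable em x y i))))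
        (λ notH _ io → decidable-stable em λ none →
          notH (infinitelyOften-shift N io , λ i t → none (i ℕ.+ N , ℕ.m≤n+m N i , t)))

    almostSure-positive : AlmostSure λ ω → ∀ i x y → ω ∈ Transition x y i → 0# < mass (κ x) y
    almostSure-positive =
      almostSure-⋂ (↣-id ℕ) λ i → almostSure-⋂ countable λ x → almostSure-⋂ countable λ y → positive i x y
      where
      positive : ∀ i x y → AlmostSure λ ω → ω ∈ Transition x y i → 0# < mass (κ x) y
      positive i x y with em {0# ≈ mass (κ x) y}
      ... | no 0≉p = almostSure-⊆ almostSure-U
        (→-measurable em (transition-measurable em x y i) (const-measurable em _))
        (λ _ _ → Dist.nonneg (κ x) y , 0≉p)
      ... | yes 0≈p = almostSure-⊆ (null⇒almostSure mT (begin-equality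
            P (λ ω → ω ∈ Transition x y i)          ≈⟨ P-cong mT ((λ t → tt , t) , proj₂) ⟩
            P (λ ω → ⊤ × ω ∈ Transition x y i)      ≈⟨ markov-step i (U-measurable em) (λ _ _ → tt) x y ⟩
            P (λ ω → ⊤ × ω i ≡ x) * mass (κ x) y    ≈⟨ *-congˡ (≈-sym 0≈p) ⟩
            P (λ ω → ⊤ × ω i ≡ x) * 0#              ≈⟨ zeroʳ _ ⟩
            0#                                      ∎))
          (→-measurable em mT (const-measurable em _))
          (λ ¬t t → ⊥-elim (¬t t))
        where
        mT : Measurable (Transition x y i)
        mT = transition-measurable em x y i

    almostSure-revisit : ∀ {B} → IsAttractor 𝓣 B → AlmostSure λ ω → ∀ N → shift N ω ∈ 𝐅 B
    almostSure-revisit {B} attractor = almostSure-⋂ (↣-id ℕ) λ N → almostSure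
      (reindex-measurable em (ℕ._+ N) (𝐅-measurable em B))
      (attractor (marginal N) (shifted N) (shifted-isLaw N))

    -- Indexing the sets by states keeps the intersection countable. Whether `𝐅 (C x)` is null does
    -- not depend on the path, so it is decided beforehand for each `x`.
    almostSure-avoid-null : ∀ (C : S → Pred S 0ℓ) →
      AlmostSure λ ω → ∀ x → P (𝐅 (C x)) ≈ 0# → ¬ ω ∈ 𝐅 (C x)
    almostSure-avoid-null C = almostSure-⋂ countable avoid
      where
      avoid : ∀ x → AlmostSure λ ω → P (𝐅 (C x)) ≈ 0# → ¬ ω ∈ 𝐅 (C x)
      avoid x with em {P (𝐅 (C x)) ≈ 0#}
      ... | yes null = almostSure-⊆ (null⇒almostSure (𝐅-measurable em (C x)) null)
        (→-measurable em (const-measurable em _) (complement (𝐅-measurable em (C x))))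
        (λ ω∉ _ → ω∉)
      ... | no notNull = almostSure-⊆ almostSure-U
        (→-measurable em (const-measurable em _) (complement (𝐅-measurable em (C x))))
        (λ _ null → ⊥-elim (notNull null))

  -- Typical paths and bottom components.

  Typical : List S → Event {S}
  Typical B ω =
    (∀ N → shift N ω ∈ 𝐅 (_∈ˡ B)) ×
    (∀ x y N → 0# < mass (κ x) y → ω ∈ InfinitelyOften x → ∃[ i ] N ℕ.≤ i × ω ∈ Transition x y i) ×
    (∀ i x y → ω ∈ Transition x y i → 0# < mass (κ x) y)

  module _ {B : List S} {ω : ℕ → S} (typical : ω ∈ Typical B) where

    typical-reachable : ∀ {i j} → i ℕ.≤ j → Path 𝓣 (ω i) (ω j)
    typical-reachable i≤j = go (ℕ.≤⇒≤′ i≤j)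
      where
      go : ∀ {i j} → i ℕ.≤′ j → Path 𝓣 (ω i) (ω j)
      go (ℕ.≤′-reflexive refl) = ε
      go (ℕ.≤′-step i≤j)       = go i≤j ◅◅ (proj₂ (proj₂ typical) _ _ _ (refl , refl) ◅ ε)

    infinitelyOften-path : ∀ {x y} → Path 𝓣 x y → ω ∈ InfinitelyOften x → ω ∈ InfinitelyOften y
    infinitelyOften-path ε           io = io
    infinitelyOften-path (0<p ◅ path) io = infinitelyOften-path path λ N →
      let i , N≤i , _ , e = proj₁ (proj₂ typical) _ _ N 0<p io in suc i , ℕ.m≤n⇒m≤1+n N≤i , e

    typical-recurrent : ∃[ b ] b ∈ˡ B × ω ∈ InfinitelyOften b
    typical-recurrent = pigeonhole em B λ N → let i , b = proj₁ typical N in i ℕ.+ N , ℕ.m≤n+m N i , b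

  Class : List S → S → Pred S 0ℓ
  Class B c y = y ∈ˡ B × Path 𝓣 c y × Path 𝓣 y c

  edges⇒path : ∀ {B x y} → Star (FiniteGraph.Edge (Graph 𝓣 B)) x y → Path 𝓣 x y
  edges⇒path ε                     = ε
  edges⇒path ((_ , _ , path) ◅ ps) = path ◅◅ edges⇒path ps

  -- By maximality of `c`, whatever in `B` the class reaches leads back to `c`, so no edge leaves
  -- the class.
  class-isBSCC : ∀ {B c} → c ∈ˡ B → (∀ {d} → d ∈ˡ B → Path 𝓣 c d → Path 𝓣 d c) →
                 IsBSCC (Graph 𝓣 B) (Class B c)
  class-isBSCC c∈B maximal = record
    { isSCC = record
      { nonempty  = _ , c∈B , ε , ε
      ; within    = proj₁
      ; connected = λ (x∈B , _ , x⇒c) (y∈B , c⇒y , _) → (x∈B , y∈B , x⇒c ◅◅ c⇒y) ◅ ε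
      ; maximal   = maximal′
      }
    ; bottom = λ (_ , c⇒x , _) (_ , y∈B , x⇒y) → y∈B , c⇒x ◅◅ x⇒y , maximal y∈B (c⇒x ◅◅ x⇒y)
    }
    where
    maximal′ : ∀ {x y} → x ∈ Class _ _ → Star (FiniteGraph.Edge (Graph 𝓣 _)) x y →
               Star (FiniteGraph.Edge (Graph 𝓣 _)) y x → y ∈ Class _ _
    maximal′ x∈C               ε                    _   = x∈C
    -- That `y` lies in `B` is read off the source of the first edge back; if either walk is empty,
    -- `y` is `x`.
    maximal′ (_ , c⇒x , x⇒c) (e ◅ es) back@((y∈B , _) ◅ _) =
      y∈B , c⇒x ◅◅ edges⇒path (e ◅ es) , edges⇒path back ◅◅ x⇒c
    maximal′ x∈C               (e ◅ es)             ε   = x∈C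

  bscc-below : ∀ {B b} → b ∈ˡ B → ∃[ c ] Path 𝓣 b c × IsBSCC (Graph 𝓣 B) (Class B c) × c ∈ˡ B
  bscc-below {B} {b} b∈B with maximal-above em {_⊑_ = Path 𝓣} ε _◅◅_ B id b∈B
  ... | c , c∈B , b⇒c , maximal = c , b⇒c , class-isBSCC c∈B maximal , c∈B

  module _ {μ : Dist S} {P : Event {S} → Carrier} (law : IsLaw 𝓣 μ P) where
    open IsLaw law
    open Measure em ℝ isProbabilityMeasure

    almostSure-typical : ∀ {B} → IsFiniteAttractor 𝓣 B → AlmostSure (Typical B)
    almostSure-typical {B} attractor = almostSure-∩ (almostSure-revisit law {B = _∈ˡ B} attractor)
      (almostSure-∩ (almostSure-recurrence law) (almostSure-positive law))

  module _ {B : List S} {ω : ℕ → S} (typical : ω ∈ Typical B) where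

    typical-enters-bscc : ∃[ i ] ω i ∈ Class B (ω i) × IsBSCC (Graph 𝓣 B) (Class B (ω i))
    typical-enters-bscc with typical-recurrent typical
    ... | b , b∈B , io with bscc-below b∈B
    -- A visit to `c` at time `i` identifies `c` with `ω i`, so the component is the member of the
    -- family `Class B` at a state of the path.
    ... | c , b⇒c , bscc , c∈B with infinitelyOften-path typical b⇒c io 0
    ... | i , _ , refl = i , (c∈B , ε , ε) , bscc

    -- Some point of `B` is visited infinitely often, in particular after time `i`, and bottomness
    -- puts it into `C`. From there every state reachable from `C` can be reached, and recurrence is
    -- inherited along paths.
    bscc-recurrent : ∀ {C i} → IsBSCC (Graph 𝓣 B) C → ω i ∈ C →
                     ∀ {x y} → x ∈ C → Path 𝓣 x y → ω ∈ InfinitelyOften y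
    bscc-recurrent {C} {i} bscc ωi∈C x∈C path with typical-recurrent typical
    ... | b , b∈B , io with io i
    ... | j , i≤j , refl = infinitelyOften-path typical (edges⇒path (connected b∈C x∈C) ◅◅ path) io
      where
      open IsBSCC bscc
      open IsSCC isSCC

      b∈C : ω j ∈ C
      b∈C = bottom ωi∈C (within ωi∈C , b∈B , typical-reachable typical i≤j)

-- The product with the automaton.

module _ (em : ExcludedMiddle 0ℓ) (ℝ : CompleteOrderedField) where
  open CompleteOrderedField ℝ
  open Probability ℝ

  module _ {S : Set} {k n : ℕ} (𝓣 : LabelledMarkovChain S k) (𝓜 : MullerAutomaton k n)
           (B : List (S × Fin n)) where
    open MullerAutomaton 𝓜
    open Chain em ℝ (𝓣 ⋉ 𝓜)

    bscc-inf : ∀ {ω C i} → ω ∈ Typical B → IsBSCC (Graph (𝓣 ⋉ 𝓜) B) C → ω i ∈ C →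
               ∀ q → (∃[ s ] (s , q) ∈ ReachableFrom 𝓣 𝓜 C) ⇔ (∀ N → ∃[ j ] N ℕ.≤ j × proj₂ (ω j) ≡ q)
    bscc-inf {ω} {C} {i} typical bscc ωi∈C q = mk⇔ to from
      where
      to : ∃[ s ] (s , q) ∈ ReachableFrom 𝓣 𝓜 C → ∀ N → ∃[ j ] N ℕ.≤ j × proj₂ (ω j) ≡ q
      to (s , x , x∈C , path) N =
        let j , N≤j , e = bscc-recurrent typical bscc ωi∈C x∈C path N in j , N≤j , cong proj₂ e

      from : (∀ N → ∃[ j ] N ℕ.≤ j × proj₂ (ω j) ≡ q) → ∃[ s ] (s , q) ∈ ReachableFrom 𝓣 𝓜 C
      -- Asking for an occurrence no earlier than `i` makes `ω j` reachable from `ω i`, a member of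
      -- `C`.
      from often with often i
      ... | j , i≤j , refl = proj₁ (ω j) , ω i , ωi∈C , typical-reachable typical i≤j

    inf⇒good : ∀ {ω C i} → ω ∈ Typical B → IsBSCC (Graph (𝓣 ⋉ 𝓜) B) C → ω i ∈ C →
               ω ∈ Inf∈ 𝓕 → IsGood 𝓣 𝓜 C
    inf⇒good typical bscc ωi∈C (F , F∈𝓕 , inf) = F , F∈𝓕 ,
      (λ s q reach → Equivalence.from (inf q) (Equivalence.to (bscc-inf typical bscc ωi∈C q) (s , reach))) ,
      (λ q q∈F → Equivalence.from (bscc-inf typical bscc ωi∈C q) (Equivalence.to (inf q) q∈F))

    good⇒inf : ∀ {ω C i} → ω ∈ Typical B → IsBSCC (Graph (𝓣 ⋉ 𝓜) B) C → ω i ∈ C →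
               IsGood 𝓣 𝓜 C → ω ∈ Inf∈ 𝓕
    good⇒inf typical bscc ωi∈C (F , F∈𝓕 , sound , complete) = F , F∈𝓕 , λ q → mk⇔
      (λ q∈F → Equivalence.to (bscc-inf typical bscc ωi∈C q) (complete q q∈F))
      (λ often → let s , reach = Equivalence.from (bscc-inf typical bscc ωi∈C q) often in sound s q reach)

    module _ (attractor : IsFiniteAttractor (𝓣 ⋉ 𝓜) B)
             {μ : Dist (S × Fin n)} {P : Event {S × Fin n} → Carrier} (law : IsLaw (𝓣 ⋉ 𝓜) μ P) where
      open IsLaw law
      open IsProbabilityMeasure isProbabilityMeasure using (nonneg)
      open Measure em ℝ isProbabilityMeasure

      P-inf≈1⇒good : P (Inf∈ 𝓕) ≈ 1# → ∀ C → IsBSCC (Graph (𝓣 ⋉ 𝓜) B) C → 0# < P (𝐅 C) → IsGood 𝓣 𝓜 C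
      P-inf≈1⇒good P-inf C bscc 0<PC =
        -- One path suffices, because goodness of `C` is a statement about reachability alone.
        let ω , (typical , inf) , i , ωi∈C = almostSure-meets
              (almostSure-∩ (almostSure-typical law {B = B} attractor) (almostSure (Inf∈-measurable em 𝓕) P-inf))
              (𝐅-measurable em C) 0<PC
        in inf⇒good typical bscc ωi∈C inf

      good⇒P-inf≈1 : (∀ C → IsBSCC (Graph (𝓣 ⋉ 𝓜) B) C → 0# < P (𝐅 C) → IsGood 𝓣 𝓜 C) → P (Inf∈ 𝓕) ≈ 1#
      good⇒P-inf≈1 good = AlmostSure.probability (almostSure-⊆
        (almostSure-∩ (almostSure-typical law {B = B} attractor) (almostSure-avoid-null law (Class B)))
        (Inf∈-measurable em 𝓕)
        λ {ω} (typical , avoid) →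
          let i , ωi∈C , bscc = typical-enters-bscc typical
              C = Class B (ω i)
              -- The path has entered `C` and avoids every null class, so `C` is not null and the
              -- hypothesis applies to it.
              0<PC = nonneg (𝐅-measurable em C) , λ 0≈P → avoid (ω i) (≈-sym 0≈P) (i , ωi∈C)
          in good⇒inf typical bscc ωi∈C (good C bscc 0<PC))

corollary54 : ExcludedMiddle 0ℓ →
  (ℝ : CompleteOrderedField) →
  let open CompleteOrderedField ℝ
      open Probability ℝ in
  {S : Set} {k n : ℕ} →
  (𝓣 : LabelledMarkovChain S k) →
  ∃ (IsFiniteAttractor 𝓣) →
  (𝓜 : MullerAutomaton k n) →
  let open MullerAutomaton 𝓜 in
  (B : List (S × Fin n)) →
  IsFiniteAttractor (𝓣 ⋉ 𝓜) B →
  (μ : Dist S) →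
  (Prob : Event {S × Fin n} → Carrier) →
  IsLaw (𝓣 ⋉ 𝓜) (μ ×δ q₀) Prob →
  (Prob (Inf∈ 𝓕) ≈ 1#)
    ⇔ ((C : Pred (S × Fin n) 0ℓ) →
        IsBSCC (Graph (𝓣 ⋉ 𝓜) B) C →
        0# < Prob (𝐅 C) →
        IsGood 𝓣 𝓜 C)
corollary54 em ℝ 𝓣 _ 𝓜 B attractor μ Prob law =
  mk⇔ (P-inf≈1⇒good em ℝ 𝓣 𝓜 B attractor law) (good⇒P-inf≈1 em ℝ 𝓣 𝓜 B attractor law)
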